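{- Let $c>1$ be a constant. If there exists an $f(N)$-time $c$-approximation algorithm for Cluster Deletion on $N$-vertex graphs, then there exists an $O(f(c'n^2)+n^4)$-time $c$-approximation algorithm for Vertex Cover on $n$-vertex graphs, where $c'$ is a constant depending only on $c$.
   Context: All graphs are finite, undirected and simple. A cluster graph is a graph in which every connected component is a clique. A cluster deletion set of a graph $G$ is a set $E_-\subseteq E(G)$ such that $G-E_-$ is a cluster graph. Cluster Deletion is the problem: given a graph $G$, find a cluster deletion set of minimum size. Vertex Cover is the problem: given a graph $G$, find a minimum-size set of vertices containing at least one endpoint of every edge of $G$. A $c$-approximation algorithm for one of these minimization problems outputs, on every input graph, a feasible solution (a cluster deletion set, respectively a vertex cover) of size at most $c$ times the minimum. -}

module Defs where

open import Data.Bool.Base using (Bool; true; false; T; not; _∧_; if_then_else_)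
open import Data.Fin.Base using (Fin; toℕ)
open import Data.Fin.Subset using (Subset; _∈_; ∣_∣)
open import Data.Integer.Base using (+_)
open import Data.Nat.Base
  using (ℕ; suc; _+_; _*_; _∸_; _≤_; _<ᵇ_; _≡ᵇ_)
open import Data.Nat.Properties using (+-0-commutativeMonoid)
open import Data.Product.Base using (∃; ∃₂; _×_; _,_)
open import Data.Rational.Base as ℚ using (ℚ; _/_)
open import Data.Sum.Base using (_⊎_)
open import Data.Vec.Base using (lookup)
open import Relation.Binary.Construct.Closure.ReflexiveTransitive using (Star)
open import Relation.Binary.PropositionalEquality.Core using (_≡_; _≢_; cong₂)
open import Relation.Nullary.Negation.Core using (¬_)
open import Relation.Unary using (Pred)
open import Level using (0ℓ)
open import Algebra.Properties.CommutativeMonoid.Sum +-0-commutativeMonoid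
  using (sum)

------------------------------------------------------------------------
-- Real constants, as two-sided Dedekind cuts

record ℝ : Set₁ where
  field
    Lower Upper     : Pred ℚ 0ℓ
    lower-inhabited : ∃ Lower
    upper-inhabited : ∃ Upper
    lower-closed    : ∀ {p q} → p ℚ.< q → Lower q → Lower p
    lower-open      : ∀ {p} → Lower p → ∃ λ q → p ℚ.< q × Lower q
    upper-closed    : ∀ {p q} → p ℚ.< q → Upper p → Upper q
    upper-open      : ∀ {q} → Upper q → ∃ λ p → p ℚ.< q × Upper p
    disjoint        : ∀ {q} → ¬ (Lower q × Upper q)
    located         : ∀ {p q} → p ℚ.< q → Lower p ⊎ Upper q

_<ℝ_ : ℚ → ℝ → Set
q <ℝ c = ℝ.Lower c q

-- a ≤ c · b for natural numbers a and b.  Since b ≥ 0, this holds exactly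
-- when a ≤ q · b for every rational q > c.
_≤_·_ : ℕ → ℝ → ℕ → Set
a ≤ c · b = ∀ q → ℝ.Upper c q → (+ a / 1) ℚ.≤ q ℚ.* (+ b / 1)

------------------------------------------------------------------------
-- Finite simple graphs

record Graph (n : ℕ) : Set where
  field
    adj    : Fin n → Fin n → Bool
    sym    : ∀ u v → adj u v ≡ adj v u
    irrefl : ∀ u → adj u u ≡ false

open Graph public using (adj)

Adj : ∀ {n} → Graph n → Fin n → Fin n → Set
Adj G u v = T (adj G u v)

bit : Bool → ℕ
bit b = if b then 1 else 0

-- Each edge {u , v} is counted once, for u < v.
edgeCount : ∀ {n} → Graph n → ℕ
edgeCount G = sum λ u → sum λ v → bit ((toℕ u <ᵇ toℕ v) ∧ adj G u v)

-- A set of edges of G is given as a spanning subgraph of G.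
_⊆ᴱ_ : ∀ {n} → Graph n → Graph n → Set
E ⊆ᴱ G = ∀ u v → Adj E u v → Adj G u v

_∖ᴱ_ : ∀ {n} → Graph n → Graph n → Graph n
G ∖ᴱ E = record
  { adj    = λ u v → adj G u v ∧ not (adj E u v)
  ; sym    = λ u v → cong₂ (λ a b → a ∧ not b) (Graph.sym G u v) (Graph.sym E u v)
  ; irrefl = λ u → cong₂ (λ a b → a ∧ not b) (Graph.irrefl G u) (Graph.irrefl E u)
  }

Component : ∀ {n} → Graph n → Fin n → Pred (Fin n) 0ℓ
Component G u v = Star (Adj G) u v

IsClique : ∀ {n} → Graph n → Pred (Fin n) 0ℓ → Set
IsClique G S = ∀ {v w} → S v → S w → v ≢ w → Adj G v w

IsClusterGraph : ∀ {n} → Graph n → Set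
IsClusterGraph G = ∀ u → IsClique G (Component G u)

IsClusterDeletionSet : ∀ {n} → Graph n → Graph n → Set
IsClusterDeletionSet G E = E ⊆ᴱ G × IsClusterGraph (G ∖ᴱ E)

IsVertexCover : ∀ {n} → Graph n → Subset n → Set
IsVertexCover G S = ∀ u v → Adj G u v → u ∈ S ⊎ v ∈ S

------------------------------------------------------------------------
-- Random access machine with uniform cost and additive arithmetic
--
-- Programs are structured and work on natural-number registers and on
-- arrays; a program mentions finitely many of either.  Each assignment,
-- memory access and branch test costs one step.  There is no
-- multiplication: at unit cost on unbounded numbers it would make the
-- machine unrealistically powerful.

Reg Arr : Set
Reg = ℕ
Arr = ℕ

data Op : Set where
  add sub : Op

⟦_⟧ : Op → ℕ → ℕ → ℕ
⟦ add ⟧ = _+_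
⟦ sub ⟧ = _∸_

infixr 5 _⨾_

data Program : Set where
  skip  : Program
  const : Reg → ℕ → Program
  arith : Reg → Op → Reg → Reg → Program
  load  : Reg → Arr → Reg → Program    -- load x a i   is  x := a[i]
  store : Arr → Reg → Reg → Program    -- store a i x  is  a[i] := x
  _⨾_   : Program → Program → Program
  ifnz  : Reg → Program → Program → Program
  while : Reg → Program → Program      -- loops as long as the register is nonzero

record State : Set where
  constructor ⟨_,_⟩
  field
    reg : Reg → ℕ
    mem : Arr → ℕ → ℕ

open State public

_[_↦_] : {A : Set} → (ℕ → A) → ℕ → A → ℕ → A
(f [ k ↦ a ]) j = if j ≡ᵇ k then a else f j

setReg : State → Reg → ℕ → State
setReg s x m = ⟨ reg s [ x ↦ m ] , mem s ⟩

setMem : State → Arr → ℕ → ℕ → State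
setMem s a i m = ⟨ reg s , mem s [ a ↦ mem s a [ i ↦ m ] ] ⟩

-- p ∶ s ⇓[ t ] s′ : started in s, the program p halts in s′ after t steps.
infix 4 _∶_⇓[_]_

data _∶_⇓[_]_ : Program → State → ℕ → State → Set where
  skip⇓  : ∀ {s} → skip ∶ s ⇓[ 1 ] s
  const⇓ : ∀ {s x m} → const x m ∶ s ⇓[ 1 ] setReg s x m
  arith⇓ : ∀ {s x o y z} →
           arith x o y z ∶ s ⇓[ 1 ] setReg s x (⟦ o ⟧ (reg s y) (reg s z))
  load⇓  : ∀ {s x a i} → load x a i ∶ s ⇓[ 1 ] setReg s x (mem s a (reg s i))
  store⇓ : ∀ {s a i x} → store a i x ∶ s ⇓[ 1 ] setMem s a (reg s i) (reg s x)
  seq⇓   : ∀ {p q s s′ s″ t t′} →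
           p ∶ s ⇓[ t ] s′ → q ∶ s′ ⇓[ t′ ] s″ → p ⨾ q ∶ s ⇓[ t + t′ ] s″
  ifnz⇓  : ∀ {x p q s s′ t} → reg s x ≢ 0 →
           p ∶ s ⇓[ t ] s′ → ifnz x p q ∶ s ⇓[ suc t ] s′
  ifz⇓   : ∀ {x p q s s′ t} → reg s x ≡ 0 →
           q ∶ s ⇓[ t ] s′ → ifnz x p q ∶ s ⇓[ suc t ] s′
  loop⇓  : ∀ {x p s s′ s″ t t′} → reg s x ≢ 0 →
           p ∶ s ⇓[ t ] s′ → while x p ∶ s′ ⇓[ t′ ] s″ →
           while x p ∶ s ⇓[ suc (t + t′) ] s″
  exit⇓  : ∀ {x p s} → reg s x ≡ 0 → while x p ∶ s ⇓[ 1 ] s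

HoldsMatrix : ∀ {n} → (ℕ → ℕ) → (Fin n → Fin n → Bool) → Set
HoldsMatrix {n} a M = ∀ u v → a (toℕ u * n + toℕ v) ≡ bit (M u v)

-- The input graph is presented by its number of vertices in register 0 and
-- its row-major adjacency matrix in array 0; everything else is zero.
record Input {n} (G : Graph n) (s : State) : Set where
  field
    order      : reg s 0 ≡ n
    matrix     : HoldsMatrix (mem s 0) (adj G)
    clean-rest : ∀ k → n * n ≤ k → mem s 0 k ≡ 0
    clean-reg  : ∀ x → x ≢ 0 → reg s x ≡ 0
    clean-mem  : ∀ a → a ≢ 0 → ∀ k → mem s a k ≡ 0

------------------------------------------------------------------------
-- Minimisation problems on graphs and their approximation

record MinimisationProblem : Set₁ where
  field
    Candidate : ℕ → Set
    Feasible  : ∀ {n} → Graph n → Candidate n → Set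
    size      : ∀ {n} → Candidate n → ℕ
    Encodes   : ∀ {n} → (ℕ → ℕ) → Candidate n → Set

  IsMinimumSize : ∀ {n} → Graph n → ℕ → Set
  IsMinimumSize G m = (∃ λ S → Feasible G S × size S ≡ m)
                    × (∀ S → Feasible G S → m ≤ size S)

ClusterDeletion : MinimisationProblem
ClusterDeletion = record
  { Candidate = Graph
  ; Feasible  = IsClusterDeletionSet
  ; size      = edgeCount
  ; Encodes   = λ a E → HoldsMatrix a (adj E)
  }

VertexCover : MinimisationProblem
VertexCover = record
  { Candidate = Subset
  ; Feasible  = IsVertexCover
  ; size      = ∣_∣
  ; Encodes   = λ a S → ∀ v → a (toℕ v) ≡ bit (lookup S v)
  }

-- P is a c-approximation algorithm for Π that makes at most f n steps on
-- every n-vertex graph.  The output is read from array 1.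
IsApproximation : ℝ → MinimisationProblem → (ℕ → ℕ) → Program → Set
IsApproximation c Π f P =
  ∀ {n} (G : Graph n) s → Input G s →
  ∃₂ λ t s′ → P ∶ s ⇓[ t ] s′ × t ≤ f n ×
    ∃ λ S → Encodes (mem s′ 1) S × Feasible G S ×
      (∀ m → IsMinimumSize G m → size S ≤ c · m)
  where open MinimisationProblem Π

_-timeApproximation_For_ : (ℕ → ℕ) → ℝ → MinimisationProblem → Set
f -timeApproximation c For Π = ∃ (IsApproximation c Π f)

_∈O_ : (ℕ → ℕ) → (ℕ → ℕ) → Set
g ∈O h = ∃₂ λ C n₀ → ∀ n → n₀ ≤ n → g n ≤ C * h n

{-# OPTIONS --safe #-}

-- For a vertex w of G, let H be the complement of G - w padded with isolated vertices to
-- N = c′ n² vertices.  Two neighbours in G - w are never in the same cluster of H, so the vertices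
-- of G that a cluster deletion set separates from a padding vertex x cover G - w; the lightest of
-- the N - n choices of x costs at most the size of the deletion set divided by N - n.  Conversely a
-- cover of G - w with t vertices gives a deletion set of size at most t N, by isolating its vertices.
-- This loses a factor N / (N - n), which need not be absorbed by integrality as c is arbitrary.
-- Hence w is taken from an optimal cover of G, of size t + 1: adding w to the cover found gives
-- c t N / (N - n) + 1 ≤ c (t + 1) once c′ is large compared with 1 / (c - 1).  One end of any edge
-- of G is such a w, so two runs of the given algorithm suffice.
module Submission where

open import Data.Bool.Base using (Bool; true; false; T; not; _∧_; _∨_; if_then_else_)
open import Data.Bool.Properties using (T?; ∧-identityʳ; ∧-zeroʳ; ∨-comm)
open import Data.Fin.Base using (Fin; zero; suc; toℕ; fromℕ<; inject≤)
open import Data.Fin.Properties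
  using (toℕ<n; toℕ-fromℕ<; fromℕ<-toℕ; toℕ-injective; toℕ-inject≤; inject≤-injective)
open import Data.Fin.Subset using (Subset; _∈_; ∣_∣; ⊤; ⊥; inside; outside)
open import Data.Fin.Subset.Properties using (∈⊤; ∣⊤∣≡n; ∣⊥∣≡0; ∣p∣≤n)
import Data.Integer.Base as ℤ
import Data.Integer.Properties as ℤ
open import Data.Nat.Base hiding (equal)
open import Data.Nat.Induction using (<-rec)
open import Data.Nat.Properties
open import Data.Nat.Solver using (module +-*-Solver)
open import Data.Product.Base using (∃; ∃₂; _×_; _,_; proj₁; proj₂)
open import Data.Rational.Base as ℚ using (ℚ; 1ℚ; ↥_; ↧ₙ_; toℚᵘ)
import Data.Rational.Properties as ℚ
open import Data.Rational.Unnormalised.Base as ℚᵘ using (mkℚᵘ)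
import Data.Rational.Unnormalised.Properties as ℚᵘ
open import Data.Sum.Base using (_⊎_; inj₁; inj₂; [_,_]′)
open import Data.Unit.Base using (tt)
open import Data.Vec.Base using ([]; _∷_; lookup; tabulate)
open import Data.Vec.Properties using ([]=⇒lookup; lookup⇒[]=; lookup∘tabulate; lookup-replicate)
open import Defs
open import Function.Base using (_∘_)
open import Function.Definitions using (Injective)
open import Relation.Binary.Construct.Closure.ReflexiveTransitive using (Star; ε; _◅_)
open import Relation.Binary.Definitions using (tri<; tri≈; tri>)
open import Relation.Binary.PropositionalEquality
open import Relation.Nullary.Decidable.Core using (yes; no; decidable-stable)
open import Relation.Nullary.Negation.Core using (¬_; contradiction)
open import Algebra.Properties.CommutativeMonoid.Sum +-0-commutativeMonoid
  using (sum; sum-cong-≗; ∑-comm; ∑-distrib-+)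

-- Booleans and equality tests

-- The guarantee of the given algorithm refers to a minimum for the gadget, whose existence is
-- available only up to double negation. This suffices, because against each rational `P / Q` above
-- `c` the claim is a decidable inequality of natural numbers. These rationals also keep a uniform
-- distance from 1: if `r` lies between 1 and `c` and has denominator `D`, they all exceed
-- `1 + 1 / D`, and `c′ = D + 2` leaves at least `(D + 1) n²` padding vertices. As the machine
-- cannot multiply, `N` is counted and the offsets of matrix rows are accumulated. The given program
-- is a black box that demands zeroed memory and leaves unknown contents behind, so each run gets
-- registers and arrays of its own by an injective renaming, and a syntactic account of what a
-- program may write shows that the rest survives. The remaining code is loop-free, and then
-- executed by a function, or a pair of nested counting loops under one rule for halting, cost and
-- invariant.

≡ᵇ-refl : ∀ n → (n ≡ᵇ n) ≡ true
≡ᵇ-refl zero    = refl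
≡ᵇ-refl (suc n) = ≡ᵇ-refl n

≢⇒≡ᵇ : ∀ {m n} → m ≢ n → (m ≡ᵇ n) ≡ false
≢⇒≡ᵇ {m} {n} m≢n with m ≡ᵇ n in eq
... | false = refl
... | true  = contradiction (≡ᵇ⇒≡ m n (subst T (sym eq) tt)) m≢n

≡ᵇ-injective : ∀ {ρ : ℕ → ℕ} → Injective _≡_ _≡_ ρ → ∀ x y → (ρ x ≡ᵇ ρ y) ≡ (x ≡ᵇ y)
≡ᵇ-injective {ρ} inj x y with x ≟ y
... | yes refl = trans (≡ᵇ-refl (ρ x)) (sym (≡ᵇ-refl x))
... | no  x≢y  = trans (≢⇒≡ᵇ (x≢y ∘ inj)) (sym (≢⇒≡ᵇ x≢y))

∧-elim : ∀ {a b} → T (a ∧ b) → T a × T b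
∧-elim {true} b = tt , b

∨-falseˡ : ∀ {a b} → a ∨ b ≡ false → a ≡ false
∨-falseˡ {false} _ = refl

∨-falseʳ : ∀ {a b} → a ∨ b ≡ false → b ≡ false
∨-falseʳ {false} eq = eq

-- Loop-free programs

loopFree : Program → Bool
loopFree (p ⨾ q)      = loopFree p ∧ loopFree q
loopFree (ifnz _ p q) = loopFree p ∧ loopFree q
loopFree (while _ _)  = false
loopFree _            = true

-- Both branches of a conditional are counted, so that the bound on the steps does not depend on the
-- state.
length : Program → ℕ
length (p ⨾ q)      = length p + length q
length (ifnz _ p q) = suc (length p + length q)
length _            = 1

-- Postconditions of concrete loop-free code can be checked by evaluation of this function. The
-- clause for `while` is a default value; `exec` is applied to loop-free programs only.
exec : Program → State → State
exec skip            s = s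
exec (const x m)     s = setReg s x m
exec (arith x o y z) s = setReg s x (⟦ o ⟧ (reg s y) (reg s z))
exec (load x a i)    s = setReg s x (mem s a (reg s i))
exec (store a i x)   s = setMem s a (reg s i) (reg s x)
exec (p ⨾ q)         s = exec q (exec p s)
exec (ifnz x p q)    s = if reg s x ≡ᵇ 0 then exec q s else exec p s
exec (while x p)     s = s

exec⇓ : ∀ p → T (loopFree p) → ∀ s → ∃ λ t → p ∶ s ⇓[ t ] exec p s × t ≤ length p
exec⇓ skip            _ s = 1 , skip⇓ , ≤-refl
exec⇓ (const x m)     _ s = 1 , const⇓ , ≤-refl
exec⇓ (arith x o y z) _ s = 1 , arith⇓ , ≤-refl
exec⇓ (load x a i)    _ s = 1 , load⇓ , ≤-refl
exec⇓ (store a i x)   _ s = 1 , store⇓ , ≤-refl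
exec⇓ (p ⨾ q) lf s with ∧-elim {loopFree p} lf
... | lfp , lfq with exec⇓ p lfp s | exec⇓ q lfq (exec p s)
... | _ , p⇓ , tp | _ , q⇓ , tq = _ , seq⇓ p⇓ q⇓ , +-mono-≤ tp tq
exec⇓ (ifnz x p q) lf s with ∧-elim {loopFree p} lf | reg s x ≡ᵇ 0 in eq
... | _ , lfq | true with exec⇓ q lfq s
...   | _ , q⇓ , tq = _ , ifz⇓ (≡ᵇ⇒≡ _ 0 (subst T (sym eq) tt)) q⇓ , s≤s (m≤n⇒m≤o+n _ tq)
exec⇓ (ifnz x p q) lf s | lfp , _ | false with exec⇓ p lfp s
...   | _ , p⇓ , tp = _ , ifnz⇓ (λ z → subst T (trans (cong (_≡ᵇ 0) (sym z)) eq) tt) p⇓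
                        , s≤s (m≤n⇒m≤n+o _ tp)

-- The frame of a program

writesReg : Program → Reg → Bool
writesReg (const x _)     y = y ≡ᵇ x
writesReg (arith x _ _ _) y = y ≡ᵇ x
writesReg (load x _ _)    y = y ≡ᵇ x
writesReg (p ⨾ q)         y = writesReg p y ∨ writesReg q y
writesReg (ifnz _ p q)    y = writesReg p y ∨ writesReg q y
writesReg (while _ p)     y = writesReg p y
writesReg _               y = false

writesArr : Program → Arr → Bool
writesArr (store a _ _) b = b ≡ᵇ a
writesArr (p ⨾ q)       b = writesArr p b ∨ writesArr q b
writesArr (ifnz _ p q)  b = writesArr p b ∨ writesArr q b
writesArr (while _ p)   b = writesArr p b
writesArr _             b = false

-- The side conditions are booleans, so that for a concrete subroutine and a concrete register or
-- array they are proved by `refl`.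
record Keeps (p : Program) (s s′ : State) : Set where
  constructor _,_
  field
    reg-kept : ∀ x → writesReg p x ≡ false → reg s′ x ≡ reg s x
    mem-kept : ∀ a → writesArr p a ≡ false → ∀ k → mem s′ a k ≡ mem s a k

open Keeps public

Keeps-refl : ∀ {p s} → Keeps p s s
Keeps-refl = (λ _ _ → refl) , (λ _ _ _ → refl)

Keeps-trans : ∀ {p s s′ s″} → Keeps p s s′ → Keeps p s′ s″ → Keeps p s s″
Keeps-trans k l = (λ x w → trans (reg-kept l x w) (reg-kept k x w))
                , (λ a w i → trans (mem-kept l a w i) (mem-kept k a w i))

Keeps-weaken : ∀ {p q s s′} → (∀ x → writesReg q x ≡ false → writesReg p x ≡ false) →
               (∀ a → writesArr q a ≡ false → writesArr p a ≡ false) →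
               Keeps p s s′ → Keeps q s s′
Keeps-weaken f g k = (λ x → reg-kept k x ∘ f x) , (λ a → mem-kept k a ∘ g a)

Keeps-seqˡ : ∀ {p q s s′} → Keeps p s s′ → Keeps (p ⨾ q) s s′
Keeps-seqˡ {p} = Keeps-weaken (λ x → ∨-falseˡ) (λ a → ∨-falseˡ)

Keeps-seqʳ : ∀ {p q s s′} → Keeps q s s′ → Keeps (p ⨾ q) s s′
Keeps-seqʳ {p} = Keeps-weaken (λ x → ∨-falseʳ {writesReg p x}) (λ a → ∨-falseʳ {writesArr p a})

keeps : ∀ {p s t s′} → p ∶ s ⇓[ t ] s′ → Keeps p s s′
keeps skip⇓  = Keeps-refl
keeps {const x m} {s} const⇓ =
  (λ y w → cong (λ b → if b then m else reg s y) w) , λ _ _ _ → refl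
keeps {arith x o y z} {s} arith⇓ =
  (λ v w → cong (λ b → if b then ⟦ o ⟧ (reg s y) (reg s z) else reg s v) w) , λ _ _ _ → refl
keeps {load x a i} {s} load⇓ =
  (λ y w → cong (λ b → if b then mem s a (reg s i) else reg s y) w) , λ _ _ _ → refl
keeps {store a i x} {s} store⇓ = (λ _ _ → refl) ,
  (λ b w k → cong (λ h → (if h then mem s a [ reg s i ↦ reg s x ] else mem s b) k) w)
keeps {p ⨾ q} (seq⇓ p⇓ q⇓) =
  Keeps-trans (Keeps-seqˡ {p} {q} (keeps p⇓)) (Keeps-seqʳ {p} {q} (keeps q⇓))
keeps {ifnz x p q} (ifnz⇓ _ p⇓) = Keeps-weaken (λ _ → ∨-falseˡ) (λ _ → ∨-falseˡ) (keeps p⇓)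
keeps {ifnz x p q} (ifz⇓ _ q⇓)  =
  Keeps-weaken (λ y → ∨-falseʳ {writesReg p y}) (λ b → ∨-falseʳ {writesArr p b}) (keeps q⇓)
keeps {while x p} (loop⇓ _ p⇓ l⇓) =
  Keeps-trans (Keeps-weaken (λ _ w → w) (λ _ w → w) (keeps p⇓)) (keeps l⇓)
keeps (exit⇓ _) = Keeps-refl

exec-keeps : ∀ p → T (loopFree p) → ∀ s → Keeps p s (exec p s)
exec-keeps p lf s = keeps (proj₁ (proj₂ (exec⇓ p lf s)))

-- For an array such as `copy k 0` with a variable `k`, the test `a ≡ᵇ a` does not reduce.
mem-setMem-same : ∀ s a i m k → mem (setMem s a i m) a k ≡ (if k ≡ᵇ i then m else mem s a k)
mem-setMem-same s a i m k = cong (λ b → (if b then mem s a [ i ↦ m ] else mem s a) k) (≡ᵇ-refl a)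

-- Renaming of registers and arrays

rename : (ℕ → ℕ) → Program → Program
rename ρ skip            = skip
rename ρ (const x m)     = const (ρ x) m
rename ρ (arith x o y z) = arith (ρ x) o (ρ y) (ρ z)
rename ρ (load x a i)    = load (ρ x) (ρ a) (ρ i)
rename ρ (store a i x)   = store (ρ a) (ρ i) (ρ x)
rename ρ (p ⨾ q)         = rename ρ p ⨾ rename ρ q
rename ρ (ifnz x p q)    = ifnz (ρ x) (rename ρ p) (rename ρ q)
rename ρ (while x p)     = while (ρ x) (rename ρ p)

view : (ℕ → ℕ) → State → State
view ρ s = ⟨ (λ x → reg s (ρ x)) , (λ a → mem s (ρ a)) ⟩

record _≈_ (s s′ : State) : Set where
  constructor _,_
  field
    reg-≈ : ∀ x → reg s x ≡ reg s′ x
    mem-≈ : ∀ a k → mem s a k ≡ mem s′ a k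

open _≈_ public

-- The given program is arbitrary, so its write set cannot be computed; outside the range of the
-- renaming it is empty.
rename-writesReg : ∀ {ρ} p {y} → (∀ x → (y ≡ᵇ ρ x) ≡ false) → writesReg (rename ρ p) y ≡ false
rename-writesReg skip            fresh = refl
rename-writesReg (const x m)     fresh = fresh x
rename-writesReg (arith x o y z) fresh = fresh x
rename-writesReg (load x a i)    fresh = fresh x
rename-writesReg (store a i x)   fresh = refl
rename-writesReg (p ⨾ q)      fresh = cong₂ _∨_ (rename-writesReg p fresh) (rename-writesReg q fresh)
rename-writesReg (ifnz x p q) fresh = cong₂ _∨_ (rename-writesReg p fresh) (rename-writesReg q fresh)
rename-writesReg (while x p)  fresh = rename-writesReg p fresh

rename-writesArr : ∀ {ρ} p {b} → (∀ a → (b ≡ᵇ ρ a) ≡ false) → writesArr (rename ρ p) b ≡ false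
rename-writesArr skip            fresh = refl
rename-writesArr (const x m)     fresh = refl
rename-writesArr (arith x o y z) fresh = refl
rename-writesArr (load x a i)    fresh = refl
rename-writesArr (store a i x)   fresh = fresh a
rename-writesArr (p ⨾ q)      fresh = cong₂ _∨_ (rename-writesArr p fresh) (rename-writesArr q fresh)
rename-writesArr (ifnz x p q) fresh = cong₂ _∨_ (rename-writesArr p fresh) (rename-writesArr q fresh)
rename-writesArr (while x p)  fresh = rename-writesArr p fresh

module _ {ρ : ℕ → ℕ} (ρ-injective : Injective _≡_ _≡_ ρ) where

  private
    setReg-≈ : ∀ {v} s → v ≈ view ρ s → ∀ x {m m′} → m ≡ m′ →
               setReg v x m ≈ view ρ (setReg s (ρ x) m′)
    setReg-≈ {v} s v≈s x {m} refl =
      (λ y → cong₂ (λ b r → if b then m else r) (sym (≡ᵇ-injective ρ-injective y x)) (reg-≈ v≈s y)) , mem-≈ v≈s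

    setMem-≈ : ∀ {v} s → v ≈ view ρ s → ∀ a {i i′ m m′} → i ≡ i′ → m ≡ m′ →
               setMem v a i m ≈ view ρ (setMem s (ρ a) i′ m′)
    setMem-≈ {v} s v≈s a {i} {m = m} refl refl = reg-≈ v≈s , λ b k →
      trans (lemma b k (b ≡ᵇ a))
            (cong (λ h → (if h then mem s (ρ a) [ i ↦ m ] else mem s (ρ b)) k)
                  (sym (≡ᵇ-injective ρ-injective b a)))
      where
      lemma : ∀ b k h → (if h then mem v a [ i ↦ m ] else mem v b) k ≡
                        (if h then mem s (ρ a) [ i ↦ m ] else mem s (ρ b)) k
      lemma b k true  = cong (λ r → if k ≡ᵇ i then m else r) (mem-≈ v≈s a k)
      lemma b k false = mem-≈ v≈s b k

  -- By injectivity an assignment to `ρ x` changes the view at `x` and nowhere else, so the two runs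
  -- stay in step. States are compared pointwise because registers and arrays are functions.
  rename⇓ : ∀ {p v v′ t s} → p ∶ v ⇓[ t ] v′ → v ≈ view ρ s →
            ∃ λ s′ → rename ρ p ∶ s ⇓[ t ] s′ × v′ ≈ view ρ s′
  rename⇓ skip⇓ v≈s = _ , skip⇓ , v≈s
  rename⇓ {const x m} {s = s} const⇓ v≈s = _ , const⇓ , setReg-≈ s v≈s x refl
  rename⇓ {arith x o y z} {s = s} arith⇓ v≈s =
    _ , arith⇓ , setReg-≈ s v≈s x (cong₂ ⟦ o ⟧ (reg-≈ v≈s y) (reg-≈ v≈s z))
  rename⇓ {load x a i} {v} {s = s} load⇓ v≈s =
    _ , load⇓ , setReg-≈ s v≈s x (trans (cong (mem v a) (reg-≈ v≈s i)) (mem-≈ v≈s a _))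
  rename⇓ {store a i x} {s = s} store⇓ v≈s =
    _ , store⇓ , setMem-≈ s v≈s a (reg-≈ v≈s i) (reg-≈ v≈s x)
  rename⇓ (seq⇓ p⇓ q⇓) v≈s with rename⇓ p⇓ v≈s
  ... | _ , p⇓′ , v≈s′ with rename⇓ q⇓ v≈s′
  ... | _ , q⇓′ , v≈s″ = _ , seq⇓ p⇓′ q⇓′ , v≈s″
  rename⇓ {ifnz x p q} (ifnz⇓ x≢0 p⇓) v≈s with rename⇓ p⇓ v≈s
  ... | _ , p⇓′ , v≈s′ = _ , ifnz⇓ (x≢0 ∘ trans (reg-≈ v≈s x)) p⇓′ , v≈s′
  rename⇓ {ifnz x p q} (ifz⇓ x≡0 q⇓) v≈s with rename⇓ q⇓ v≈s
  ... | _ , q⇓′ , v≈s′ = _ , ifz⇓ (trans (sym (reg-≈ v≈s x)) x≡0) q⇓′ , v≈s′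
  rename⇓ {while x p} (loop⇓ x≢0 p⇓ l⇓) v≈s with rename⇓ p⇓ v≈s
  ... | _ , p⇓′ , v≈s′ with rename⇓ l⇓ v≈s′
  ... | _ , l⇓′ , v≈s″ = _ , loop⇓ (x≢0 ∘ trans (reg-≈ v≈s x)) p⇓′ l⇓′ , v≈s″
  rename⇓ {while x p} (exit⇓ x≡0) v≈s = _ , exit⇓ (trans (sym (reg-≈ v≈s x)) x≡0) , v≈s

-- Expressions

infixl 6 _⊕_ _⊖_
infix 4 _≔_ _[_]≔_

data Expr : Set where
  var     : Reg → Expr
  lit     : ℕ → Expr
  _⊕_ _⊖_ : Expr → Expr → Expr
  _!_     : Arr → Expr → Expr

-- A register is copied by subtracting zero, because m ∸ 0 reduces to m.
eval : Reg → Expr → Program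
eval k (var x) = const k 0 ⨾ arith k sub x k
eval k (lit m) = const k m
eval k (e ⊕ f) = eval k e ⨾ eval (suc k) f ⨾ arith k add k (suc k)
eval k (e ⊖ f) = eval k e ⨾ eval (suc k) f ⨾ arith k sub k (suc k)
eval k (a ! e) = eval k e ⨾ load k a k

-- Registers from 8 on hold the intermediate values.
_≔_ : Reg → Expr → Program
x ≔ e = eval 8 e ⨾ const 7 0 ⨾ arith x sub 8 7

_[_]≔_ : Arr → Expr → Expr → Program
a [ e ]≔ f = eval 8 e ⨾ eval 9 f ⨾ store a 8 9

-- Nested loops: the row is in register 1 and the column in register 3,
-- their bounds are in registers 5 and 6.

row col : Expr
row = var 1
col = var 3

-- Registers 2 and 4 hold the numbers of rows and columns still to be done, because a loop can only
-- test whether a register is nonzero.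
gridStart rowStart rowEnd colEnd : Program
gridStart = const 1 0 ⨾ arith 2 sub 5 1
rowStart  = const 3 0 ⨾ arith 4 sub 6 3
colEnd    = const 7 1 ⨾ arith 3 add 3 7 ⨾ arith 4 sub 6 3
rowEnd    = const 7 1 ⨾ arith 1 add 1 7 ⨾ arith 2 sub 5 1

grid : (before cell after : Program) → Program
grid before cell after =
  gridStart ⨾ while 2 ((before ⨾ rowStart) ⨾ while 4 (cell ⨾ colEnd) ⨾ after ⨾ rowEnd)

-- With `R` rows and `M` columns the cost is at most `3 + (7 + length before + length after) * R +
-- (4 + length cell) * (R * M)`; the 14 is 3 + 7 + 4.
gridCost : (before cell after : Program) → ℕ
gridCost before cell after = 14 + (length before + length cell + length after)

-- Halting within a time bound, and the loop rules

Halts : Program → State → ℕ → (State → Set) → Set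
Halts p s k Q = ∃₂ λ t s′ → p ∶ s ⇓[ t ] s′ × t ≤ k × Q s′

-- The index of the invariant is the number of remaining iterations, which is both the termination
-- measure and the factor in the cost. Each iteration costs `k` for the body and 1 for the test.
while-halts : ∀ {x p k} (Inv : ℕ → State → Set) →
              (∀ {j s} → Inv (suc j) s → reg s x ≢ 0 × Halts p s k (Inv j)) →
              (∀ {s} → Inv 0 s → reg s x ≡ 0) →
              ∀ j {s} → Inv j s → Halts (while x p) s (suc (j * suc k)) (Inv 0)
while-halts Inv step stop zero    inv = 1 , _ , exit⇓ (stop inv) , ≤-refl , inv
while-halts {k = k} Inv step stop (suc j) inv with step inv
... | x≢0 , t , _ , p⇓ , t≤k , inv′ with while-halts Inv step stop j inv′
...   | t′ , _ , l⇓ , t′≤ , inv″ = _ , _ , loop⇓ x≢0 p⇓ l⇓ , bound , inv″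
  where
  open ≤-Reasoning
  bound : suc (t + t′) ≤ suc (suc k + j * suc k)
  bound = begin
    suc (t + t′)                ≤⟨ s≤s (+-mono-≤ t≤k t′≤) ⟩
    suc (k + suc (j * suc k))   ≡⟨ cong suc (+-suc k _) ⟩
    suc (suc k + j * suc k)     ∎

exec-halts : ∀ {p} → T (loopFree p) → ∀ {s} {Q : State → Set} → Q (exec p s) → Halts p s (length p) Q
exec-halts {p} lf {s} q with exec⇓ p lf s
... | t , p⇓ , t≤ = t , _ , p⇓ , t≤ , q

-- The continuation also receives the frame of the first program, so a postcondition need only speak
-- of what that program changes.
seq-halts : ∀ {p q s k l} {Q Q′ : State → Set} → Halts p s k Q →
            (∀ {s′} → Keeps p s s′ → Q s′ → Halts q s′ l Q′) → Halts (p ⨾ q) s (k + l) Q′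
seq-halts (_ , _ , p⇓ , t≤ , h) next with next (keeps p⇓) h
... | _ , _ , q⇓ , t′≤ , h′ = _ , _ , seq⇓ p⇓ q⇓ , +-mono-≤ t≤ t′≤ , h′

-- Registers 1 to 4 are the counters of `grid`, and 5 and 6 its bounds. Register 7 may be written:
-- it is scratch space of every assignment.
record SparesCounters (p : Program) : Set where
  constructor spares
  field
    no-loop : T (loopFree p)
    keeps₁  : writesReg p 1 ≡ false
    keeps₂  : writesReg p 2 ≡ false
    keeps₃  : writesReg p 3 ≡ false
    keeps₄  : writesReg p 4 ≡ false
    keeps₅  : writesReg p 5 ≡ false
    keeps₆  : writesReg p 6 ≡ false

pattern safe = spares tt refl refl refl refl refl refl

-- Here `I i` is the invariant before row `i`, and `J i j` the one before column `j` of that row.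
-- Every obligation concerns loop-free code and comes with the frame of the whole grid since `s₀`,
-- so values that no iteration touches stay out of the invariants.
module _ {before cell after : Program}
         (safe-before : SparesCounters before) (safe-cell : SparesCounters cell) (safe-after : SparesCounters after)
         {R M : ℕ} {s₀ : State} (rows : reg s₀ 5 ≡ R) (cols : reg s₀ 6 ≡ M)
         (I : ℕ → State → Set) (J : ℕ → ℕ → State → Set)
         (start : I 0 (exec gridStart s₀))
         (row-start : ∀ {i} s → i < R → reg s 1 ≡ i → Keeps (grid before cell after) s₀ s →
                      I i s → J i 0 (exec (before ⨾ rowStart) s))
         (step : ∀ {i j} s → i < R → j < M → reg s 1 ≡ i → reg s 3 ≡ j →
                 Keeps (grid before cell after) s₀ s →
                 J i j s → J i (suc j) (exec (cell ⨾ colEnd) s))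
         (row-end : ∀ {i} s → i < R → reg s 1 ≡ i → Keeps (grid before cell after) s₀ s →
                    J i M s → I (suc i) (exec (after ⨾ rowEnd) s))
  where

  private
    G : Program
    G = grid before cell after

    writes-G : ∀ {x} → writesReg before x ≡ false → writesReg cell x ≡ false →
               writesReg after x ≡ false → (x ≡ᵇ 1) ≡ false → (x ≡ᵇ 2) ≡ false → (x ≡ᵇ 3) ≡ false →
               (x ≡ᵇ 4) ≡ false → (x ≡ᵇ 7) ≡ false → writesReg G x ≡ false
    writes-G b c a e₁ e₂ e₃ e₄ e₇ rewrite b | c | a | e₁ | e₂ | e₃ | e₄ | e₇ = refl

    module B = SparesCounters safe-before
    module C = SparesCounters safe-cell
    module A = SparesCounters safe-after

    G-keeps-5 : writesReg G 5 ≡ false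
    G-keeps-5 = writes-G {5} B.keeps₅ C.keeps₅ A.keeps₅ refl refl refl refl refl

    G-keeps-6 : writesReg G 6 ≡ false
    G-keeps-6 = writes-G {6} B.keeps₆ C.keeps₆ A.keeps₆ refl refl refl refl refl

    body : Program
    body = (before ⨾ rowStart) ⨾ while 4 (cell ⨾ colEnd) ⨾ after ⨾ rowEnd

    from-body : ∀ {s s′} → Keeps body s s′ → Keeps G s s′
    from-body {s} {s′} k = Keeps-seqʳ {gridStart} {while 2 body}
                       (Keeps-weaken {body} {while 2 body} (λ _ w → w) (λ _ w → w) k)

    from-start : ∀ {s s′} → Keeps (before ⨾ rowStart) s s′ → Keeps G s s′
    from-start k = from-body (Keeps-seqˡ {_} {while 4 (cell ⨾ colEnd) ⨾ after ⨾ rowEnd} k)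

    from-cols : ∀ {s s′} → Keeps (cell ⨾ colEnd) s s′ → Keeps G s s′
    from-cols k = from-body (Keeps-seqʳ {before ⨾ rowStart} (Keeps-seqˡ {_} {after ⨾ rowEnd}
                     (Keeps-weaken {_} {while 4 (cell ⨾ colEnd)} (λ _ w → w) (λ _ w → w) k)))

    from-end : ∀ {s s′} → Keeps (after ⨾ rowEnd) s s′ → Keeps G s s′
    from-end k = from-body (Keeps-seqʳ {before ⨾ rowStart} (Keeps-seqʳ {while 4 (cell ⨾ colEnd)} k))

    -- Indexed by the number of rows left, as `while-halts` requires; the equation `i + r ≡ R`
    -- recovers the position.
    record Row (r : ℕ) (s : State) : Set where
      constructor mkRow
      field
        i      : ℕ
        i+r    : i + r ≡ R
        at-row : reg s 1 ≡ i
        left   : reg s 2 ≡ R ∸ i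
        kept   : Keeps G s₀ s
        inv    : I i s

    record Cell (i r : ℕ) (s : State) : Set where
      constructor mkCell
      field
        j       : ℕ
        j+r     : j + r ≡ M
        at-row  : reg s 1 ≡ i
        at-col  : reg s 3 ≡ j
        left    : reg s 4 ≡ M ∸ j
        kept    : Keeps G s₀ s
        inv     : J i j s

    remaining : ∀ {m} i r → i + r ≡ m → m ∸ i ≡ r
    remaining i r eq = trans (cong (_∸ i) (sym eq)) (m+n∸m≡n i r)

    below : ∀ {m} i r → i + suc r ≡ m → i < m
    below i r eq = subst (i <_) eq (m<m+n i (s≤s z≤n))

    columns : ∀ {i} → i < R → ∀ r {s} → Cell i r s →
              Halts (while 4 (cell ⨾ colEnd)) s (suc (r * suc (length cell + 3))) (Cell i 0)
    columns {i} i<R = while-halts (Cell i) step′ stop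
      where
      stop : ∀ {s} → Cell i 0 s → reg s 4 ≡ 0
      stop (mkCell j j+r _ _ left _ _) = trans left (remaining j 0 j+r)

      step′ : ∀ {r s} → Cell i (suc r) s → reg s 4 ≢ 0 × Halts (cell ⨾ colEnd) s (length cell + 3) (Cell i r)
      step′ {r} {s} (mkCell j j+r at-row at-col left kept inv) =
        (λ z → contradiction (trans (sym (remaining j _ j+r)) (trans (sym left) z)) λ ()) ,
        exec-halts {cell ⨾ colEnd} lf′
          (mkCell (suc j) (trans (sym (+-suc j r)) j+r) at-row′ at-col′ left′ kept′
                  (step s i<R (below j r j+r) at-row at-col kept inv))
        where
        lf′ : T (loopFree cell ∧ true)
        lf′ = subst T (sym (∧-identityʳ _)) C.no-loop
        kc = exec-keeps cell C.no-loop s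
        kept′ = Keeps-trans kept (from-cols (exec-keeps (cell ⨾ colEnd) lf′ s))
        at-row′ = trans (reg-kept kc 1 C.keeps₁) at-row
        at-col′ = trans (cong (_+ 1) (trans (reg-kept kc 3 C.keeps₃) at-col)) (+-comm j 1)
        left′ = cong₂ _∸_ (trans (reg-kept kc 6 C.keeps₆) (trans (reg-kept kept 6 G-keeps-6) cols)) at-col′

    row-cost : ℕ
    row-cost = (length before + 2) + (suc (M * suc (length cell + 3)) + (length after + 3))

    a-row : ∀ {r s} → Row (suc r) s → reg s 2 ≢ 0 × Halts body s row-cost (Row r)
    a-row {r} {s} (mkRow i i+r at-row left kept inv) =
      (λ z → contradiction (trans (sym (remaining i _ i+r)) (trans (sym left) z)) λ ()) ,
      seq-halts (exec-halts {before ⨾ rowStart} lf₁ (mkCell 0 refl at-row₁ refl left₁ kept₁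
                   (row-start s i<R at-row kept inv)))
        λ _ c → seq-halts (columns i<R M c) λ {s′} _ c′ → finish c′
      where
      i<R = below i r i+r
      lf₁ : T (loopFree before ∧ true)
      lf₁ = subst T (sym (∧-identityʳ _)) B.no-loop
      lf₂ : T (loopFree after ∧ true)
      lf₂ = subst T (sym (∧-identityʳ _)) A.no-loop
      kb = exec-keeps before B.no-loop s
      at-row₁ = trans (reg-kept kb 1 B.keeps₁) at-row
      left₁ = trans (reg-kept kb 6 B.keeps₆) (trans (reg-kept kept 6 G-keeps-6) cols)
      kept₁ = Keeps-trans kept (from-start (exec-keeps (before ⨾ rowStart) lf₁ s))

      finish : ∀ {s′} → Cell i 0 s′ → Halts (after ⨾ rowEnd) s′ (length after + 3) (Row r)
      finish {s′} (mkCell j j+r at-row′ _ _ kept′ inv′) =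
        exec-halts {after ⨾ rowEnd} lf₂
          (mkRow (suc i) (trans (sym (+-suc i r)) i+r) at-row″ left″
                 (Keeps-trans kept′ (from-end (exec-keeps (after ⨾ rowEnd) lf₂ s′)))
                 (row-end s′ i<R at-row′ kept′
                   (subst (λ j → J i j s′) (trans (sym (+-identityʳ j)) j+r) inv′)))
        where
        ka = exec-keeps after A.no-loop s′
        at-row″ = trans (cong (_+ 1) (trans (reg-kept ka 1 A.keeps₁) at-row′)) (+-comm i 1)
        left″ = cong₂ _∸_ (trans (reg-kept ka 5 A.keeps₅) (trans (reg-kept kept′ 5 G-keeps-5) rows)) at-row″

  -- The cost is a combination of `R * M`, `R` and 1, and `Y` bounds each of the three.
  grid-halts : ∀ {Y} → R * M ≤ Y → R ≤ Y → 1 ≤ Y →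
               Halts G s₀ (gridCost before cell after * Y) (λ s → Keeps G s₀ s × I R s)
  grid-halts {Y} RM≤Y R≤Y 1≤Y
    with seq-halts (exec-halts {gridStart} tt (mkRow 0 refl refl (cong (_∸ 0) rows)
                     (Keeps-seqˡ {gridStart} {while 2 body} (exec-keeps gridStart tt s₀)) start))
                   (λ _ → while-halts Row a-row (λ (mkRow i i+r _ left _ _) →
                        trans left (remaining i 0 i+r)) R)
  ... | t , s′ , g⇓ , t≤ , mkRow i i+r _ _ kept inv =
    t , s′ , g⇓ , ≤-trans t≤ bound , kept , subst (λ i → I i s′) (trans (sym (+-identityʳ i)) i+r) inv
    where
    open ≤-Reasoning
    open +-*-Solver
    lb = length before ; lc = length cell ; la = length after
    bound : 2 + suc (R * suc row-cost) ≤ gridCost before cell after * Y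
    bound = begin
      2 + suc (R * suc row-cost)
        ≡⟨ solve 5 (λ R M b c a →
              con 3 :+ R :* (con 1 :+ ((b :+ con 2) :+ (con 1 :+ M :* (con 1 :+ (c :+ con 3)) :+ (a :+ con 3)))) :=
              con 3 :* con 1 :+ (con 7 :+ a :+ b) :* R :+ (c :+ con 4) :* (R :* M)) refl R M lb lc la ⟩
      3 * 1 + (7 + la + lb) * R + (lc + 4) * (R * M)
        ≤⟨ +-mono-≤ (+-mono-≤ (*-monoʳ-≤ 3 1≤Y) (*-monoʳ-≤ (7 + la + lb) R≤Y)) (*-monoʳ-≤ (lc + 4) RM≤Y) ⟩
      3 * Y + (7 + la + lb) * Y + (lc + 4) * Y
        ≡⟨ solve 4 (λ Y b c a → con 3 :* Y :+ (con 7 :+ a :+ b) :* Y :+ (c :+ con 4) :* Y :=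
                      (con 14 :+ (b :+ c :+ a)) :* Y) refl Y lb lc la ⟩
      (14 + (lb + lc + la)) * Y ∎

-- Approximation within a real factor

module _ where
  open import Data.Integer.Base using (+_; -[1+_])

  -- All that is used of `q = P / Q`: it moves the later estimates into the natural numbers.
  record IsRatio (q : ℚ) (P Q : ℕ) : Set where
    field
      ratio⇒ : ∀ a b → + a ℚ./ 1 ℚ.≤ q ℚ.* (+ b ℚ./ 1) → a * Q ≤ P * b
      ratio⇐ : ∀ a b → a * Q ≤ P * b → + a ℚ./ 1 ℚ.≤ q ℚ.* (+ b ℚ./ 1)

  open IsRatio public

  toℚᵘ-ℕ : ∀ a → toℚᵘ (+ a ℚ./ 1) ℚᵘ.≃ mkℚᵘ (+ a) 0
  toℚᵘ-ℕ a = ℚ.toℚᵘ-fromℚᵘ (mkℚᵘ (+ a) 0)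

  toℚᵘ-*ℕ : ∀ q b → toℚᵘ (q ℚ.* (+ b ℚ./ 1)) ℚᵘ.≃ toℚᵘ q ℚᵘ.* mkℚᵘ (+ b) 0
  toℚᵘ-*ℕ q b = ℚᵘ.≃-trans (ℚ.toℚᵘ-homo-* q _) (ℚᵘ.*-congˡ {toℚᵘ q} (toℚᵘ-ℕ b))

  isRatio : ∀ q {P} → ↥ q ≡ + P → IsRatio q P (↧ₙ q)
  isRatio q@(ℚ.mkℚ _ d _) {P} refl = record { ratio⇒ = to ; ratio⇐ = from }
    where
    left : ∀ a → + a ℤ.* + (suc d * 1) ≡ + (a * suc d)
    left a = trans (sym (ℤ.pos-* a _)) (cong (λ x → + (a * x)) (*-identityʳ (suc d)))
    right : ∀ b → (+ P ℤ.* + b) ℤ.* + 1 ≡ + (P * b)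
    right b = trans (ℤ.*-identityʳ _) (sym (ℤ.pos-* P b))
    to : ∀ a b → + a ℚ./ 1 ℚ.≤ q ℚ.* (+ b ℚ./ 1) → a * suc d ≤ P * b
    to a b le = ℤ.drop‿+≤+ (subst₂ ℤ._≤_ (left a) (right b) (ℚᵘ.drop-*≤*
      (ℚᵘ.≤-respˡ-≃ (toℚᵘ-ℕ a) (ℚᵘ.≤-respʳ-≃ (toℚᵘ-*ℕ q b) (ℚ.toℚᵘ-mono-≤ le)))))
    from : ∀ a b → a * suc d ≤ P * b → + a ℚ./ 1 ℚ.≤ q ℚ.* (+ b ℚ./ 1)
    from a b le = ℚ.toℚᵘ-cancel-≤ (ℚᵘ.≤-respˡ-≃ (ℚᵘ.≃-sym (toℚᵘ-ℕ a))
      (ℚᵘ.≤-respʳ-≃ (ℚᵘ.≃-sym (toℚᵘ-*ℕ q b))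
        (ℚᵘ.*≤* (subst₂ ℤ._≤_ (sym (left a)) (sym (right b)) (ℤ.+≤+ le)))))

  -- The numerator of a fraction above 1 exceeds its denominator `d` by at least 1, so the fraction
  -- is at least `(d + 1) / d`. Hence so is every larger `q`, whatever its own denominator.
  above-one : ∀ {r q} → 1ℚ ℚ.< r → r ℚ.< q →
              ∃ λ P → ↥ q ≡ + P × suc (↧ₙ r) * ↧ₙ q ≤ P * ↧ₙ r
  above-one {ℚ.mkℚ (+ p) d _} {ℚ.mkℚ (+ P) e _} (ℚ.*<* 1<r) (ℚ.*<* r<q) = P , refl , (begin
    suc (suc d) * suc e ≤⟨ *-monoˡ-≤ (suc e) d<p ⟩
    p * suc e           ≤⟨ <⇒≤ (ℤ.drop‿+<+ (subst₂ ℤ._<_ (sym (ℤ.pos-* p _)) (sym (ℤ.pos-* P _)) r<q)) ⟩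
    P * suc d           ∎)
    where
    open ≤-Reasoning
    d<p : suc (suc d) ≤ p
    d<p = ℤ.drop‿+<+ (subst₂ ℤ._<_ (ℤ.*-identityˡ _) (ℤ.*-identityʳ _) 1<r)
  above-one {ℚ.mkℚ (+ p) d _} { ℚ.mkℚ -[1+ P ] e _} 1<r (ℚ.*<* r<q)
    with subst (ℤ._< -[1+ P ] ℤ.* + suc d) (sym (ℤ.pos-* p _)) r<q
  ... | ()
  above-one {ℚ.mkℚ -[1+ p ] d _} (ℚ.*<* ())

lower<upper : (c : ℝ) → ∀ {p q} → ℝ.Lower c p → ℝ.Upper c q → p ℚ.< q
lower<upper c {p} {q} lp uq with ℚ.<-cmp p q
... | tri< p<q _ _ = p<q
... | tri≈ _ refl _ = contradiction (lp , uq) (ℝ.disjoint c)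
... | tri> _ _ q<p = contradiction (lp , ℝ.upper-closed c q<p uq) (ℝ.disjoint c)

record Exceeds (D : ℕ) (c : ℝ) (P Q : ℕ) : Set where
  field
    {q}   : ℚ
    c<q   : ℝ.Upper c q
    ratio : IsRatio q P Q
    gap   : suc D * Q ≤ P * D

record Gap (D : ℕ) (c : ℝ) : Set where
  field
    bounded : ∀ q → ℝ.Upper c q → ∃₂ λ P Q → IsRatio q P Q × suc D * Q ≤ P * D

-- A rational strictly between 1 and `c` exists because lower cuts are open. Its denominator serves
-- all rationals above `c` at once, which is why the padding can depend on `c` alone.
gap-above-one : ∀ c → 1ℚ <ℝ c → ∃ λ D → Gap D c
gap-above-one c 1<c with ℝ.lower-open c 1<c
... | r , 1<r , r<c = ↧ₙ r , record { bounded = λ q c<q →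
  let P , eq , le = above-one 1<r (lower<upper c r<c c<q) in P , ↧ₙ q , isRatio q eq , le }

≤·-elim : ∀ {D c} a b {P Q} → a ≤ c · b → Exceeds D c P Q → a * Q ≤ P * b
≤·-elim a b le ex = ratio⇒ (Exceeds.ratio ex) a b (le _ (Exceeds.c<q ex))

≤·-intro : ∀ {D c} a b → Gap D c → (∀ {P Q} → Exceeds D c P Q → a * Q ≤ P * b) → a ≤ c · b
≤·-intro a b g le q c<q = let P , Q , ratio , gap = Gap.bounded g q c<q in
  ratio⇐ ratio a b (le (record { c<q = c<q ; ratio = ratio ; gap = gap }))

-- Here P / Q > 1 approximates c, k vertices of the gadget lie outside G, and t + 1 is the size of
-- an optimal cover: the additive 1 for the guessed vertex is paid for by the excess of P / Q over 1.
absorb : ∀ {P Q D n k a t N} → suc D * Q ≤ P * D → suc D * (n * n) ≤ k → 0 < k → N ≡ k + n → t ≤ n →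
         k * a * Q ≤ P * (t * N) → suc a * Q ≤ P * suc t
absorb {P} {Q} {D} {n} {k} {a} {t} {N} gap big 0<k refl t≤n approx =
  *-cancelˡ-≤ k {{>-nonZero 0<k}} (begin
    k * (suc a * Q)                   ≡⟨ solve 3 (λ k a Q → k :* ((con 1 :+ a) :* Q) := k :* a :* Q :+ k :* Q) refl k a Q ⟩
    k * a * Q + k * Q                 ≤⟨ +-monoˡ-≤ (k * Q) approx ⟩
    P * (t * (k + n)) + k * Q         ≡⟨ solve 5 (λ P t k n Q → P :* (t :* (k :+ n)) :+ k :* Q
                                            := P :* t :* k :+ (P :* (t :* n) :+ k :* Q)) refl P t k n Q ⟩
    P * t * k + (P * (t * n) + k * Q) ≤⟨ +-monoʳ-≤ (P * t * k) (≤-trans (+-monoˡ-≤ (k * Q) (*-monoʳ-≤ P (*-monoˡ-≤ n t≤n))) excess) ⟩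
    P * t * k + P * k                 ≡⟨ solve 3 (λ P t k → P :* t :* k :+ P :* k := k :* (P :* (con 1 :+ t))) refl P t k ⟩
    k * (P * suc t)                   ∎)
  where
  open ≤-Reasoning
  open +-*-Solver
  -- Multiplied by `D + 1`, the first summand is at most `P * k` as the padding is large, and the
  -- second at most `k * P * D` by the gap; together they give `(D + 1) * (P * k)`.
  excess : P * (n * n) + k * Q ≤ P * k
  excess = *-cancelˡ-≤ (suc D) (begin
    suc D * (P * (n * n) + k * Q)       ≡⟨ solve 5 (λ D P m k Q → (con 1 :+ D) :* (P :* m :+ k :* Q)
                                              := P :* ((con 1 :+ D) :* m) :+ k :* ((con 1 :+ D) :* Q)) refl D P (n * n) k Q ⟩
    P * (suc D * (n * n)) + k * (suc D * Q) ≤⟨ +-mono-≤ (*-monoʳ-≤ P big) (*-monoʳ-≤ k gap) ⟩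
    P * k + k * (P * D)                 ≡⟨ solve 3 (λ P k D → P :* k :+ k :* (P :* D) := (con 1 :+ D) :* (P :* k)) refl P k D ⟩
    suc D * (P * k)                     ∎)

-- Sums

sum-mono : ∀ {n} {f g : Fin n → ℕ} → (∀ u → f u ≤ g u) → sum f ≤ sum g
sum-mono {zero}  f≤g = z≤n
sum-mono {suc n} f≤g = +-mono-≤ (f≤g zero) (sum-mono (f≤g ∘ suc))

sum-const : ∀ n k → sum {n} (λ _ → k) ≡ n * k
sum-const zero    k = refl
sum-const (suc n) k = cong (k +_) (sum-const n k)

sum-*ʳ : ∀ {n} (f : Fin n → ℕ) k → sum (λ u → f u * k) ≡ sum f * k
sum-*ʳ {zero}  f k = refl
sum-*ʳ {suc n} f k = trans (cong (f zero * k +_) (sum-*ʳ (f ∘ suc) k)) (sym (*-distribʳ-+ k (f zero) _))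

sum-last : ∀ n (h : ℕ → ℕ) → sum {suc n} (h ∘ toℕ) ≡ sum {n} (h ∘ toℕ) + h n
sum-last zero    h = +-comm (h 0) 0
sum-last (suc n) h = trans (cong (h 0 +_) (sum-last n (h ∘ suc))) (sym (+-assoc (h 0) _ _))

sum-inject≤ : ∀ {m n} (m≤n : m ≤ n) (f : Fin n → ℕ) → sum (λ u → f (inject≤ u m≤n)) ≤ sum f
sum-inject≤ {zero}          m≤n       f = z≤n
sum-inject≤ {suc m} {suc n} (s≤s m≤n) f = +-monoʳ-≤ (f zero) (sum-inject≤ m≤n (f ∘ suc))

sum-above : ∀ m {n a} (f : Fin n → ℕ) → (∀ u → m ≤ toℕ u → a ≤ f u) → (n ∸ m) * a ≤ sum f
sum-above zero    {n} {a} f a≤f = subst (_≤ sum f) (sum-const n a) (sum-mono (λ u → a≤f u z≤n))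
sum-above (suc m) {zero}  f a≤f = z≤n
sum-above (suc m) {suc n} f a≤f =
  ≤-trans (sum-above m (f ∘ suc) (λ u m≤u → a≤f (suc u) (s≤s m≤u))) (m≤n+m _ (f zero))

sum-indicator : ∀ {n} (w : Fin n) → sum {n} (λ u → bit (toℕ u ≡ᵇ toℕ w)) ≡ 1
sum-indicator {suc n} zero    = cong suc (trans (sum-const n 0) (*-zeroʳ n))
sum-indicator {suc n} (suc w) = sum-indicator w

∣∣≡sum : ∀ {n} (S : Subset n) → ∣ S ∣ ≡ sum (λ u → bit (lookup S u))
∣∣≡sum []            = refl
∣∣≡sum (inside  ∷ S) = cong suc (∣∣≡sum S)
∣∣≡sum (outside ∷ S) = ∣∣≡sum S

-- Booleans

bit-∨ : ∀ a b → bit (a ∨ b) ≤ bit a + bit b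
bit-∨ true  b = s≤s z≤n
bit-∨ false b = ≤-refl

bit-mono : ∀ {a b} → (T a → T b) → bit a ≤ bit b
bit-mono {false}         f = z≤n
bit-mono {true} {true}   f = ≤-refl
bit-mono {true} {false}  f with () ← f tt

bit-∧ : ∀ a b → bit (a ∧ b) ≡ bit b * bit a
bit-∧ true  b = sym (*-identityʳ (bit b))
bit-∧ false b = sym (*-zeroʳ (bit b))

T-not : ∀ {b} → T (not b) → ¬ T b
T-not {false} _ ()

not-T : ∀ {b} → ¬ T b → T (not b)
not-T {false} _ = tt
not-T {true}  f with () ← f tt

∧-intro : ∀ {a b} → T a → T b → T (a ∧ b)
∧-intro {true} _ b = b

∨-elim : ∀ {a b} → T (a ∨ b) → T a ⊎ T b
∨-elim {true}  _ = inj₁ tt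
∨-elim {false} b = inj₂ b

∨-introˡ : ∀ {a b} → T a → T (a ∨ b)
∨-introˡ {true} _ = tt

∨-introʳ : ∀ {a b} → T b → T (a ∨ b)
∨-introʳ {true}  _ = tt
∨-introʳ {false} b = b

<ᵇ-or-≥ᵇ : ∀ m n → bit (m <ᵇ n) + bit (n <ᵇ m) ≤ 1
<ᵇ-or-≥ᵇ m n with m <ᵇ n in p | n <ᵇ m in q
... | false | false = z≤n
... | false | true  = ≤-refl
... | true  | false = ≤-refl
... | true  | true  = contradiction (<ᵇ⇒< n m (subst T (sym q) tt)) (<-asym (<ᵇ⇒< m n (subst T (sym p) tt)))

≡ᵇ-sym : ∀ m n → (m ≡ᵇ n) ≡ (n ≡ᵇ m)
≡ᵇ-sym m n with m ≟ n
... | yes refl = refl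
... | no  m≢n  = trans (≢⇒≡ᵇ m≢n) (sym (≢⇒≡ᵇ (m≢n ∘ sym)))

∈⇒T : ∀ {n} {S : Subset n} {u} → u ∈ S → T (lookup S u)
∈⇒T u∈S = subst T (sym ([]=⇒lookup u∈S)) tt

T⇒∈ : ∀ {n} {S : Subset n} {u} → T (lookup S u) → u ∈ S
T⇒∈ {S = S} {u} t with lookup S u in eq
... | true = lookup⇒[]= u S eq

-- Isolating the vertices of a set

module _ {N} (H : Graph N) (σ : Fin N → Bool) where

  incident : Graph N
  incident = record
    { adj    = λ u v → adj H u v ∧ (σ u ∨ σ v)
    ; sym    = λ u v → cong₂ _∧_ (Graph.sym H u v) (∨-comm (σ u) (σ v))
    ; irrefl = λ u → cong (_∧ (σ u ∨ σ u)) (Graph.irrefl H u)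
    }

  -- Charge each edge to an endpoint in `σ`. A vertex `u` is charged at most once for each `v`,
  -- since `u < v` and `v < u` exclude each other.
  incident-count : edgeCount incident ≤ sum (bit ∘ σ) * N
  incident-count = begin
    edgeCount incident
      ≤⟨ sum-mono (λ u → sum-mono (λ v → cell u v)) ⟩
    sum (λ u → sum (λ v → bit (σ u) * lt u v + bit (σ v) * lt u v))
      ≡⟨ sum-cong-≗ (λ u → ∑-distrib-+ (λ v → bit (σ u) * lt u v) (λ v → bit (σ v) * lt u v)) ⟩
    sum (λ u → sum (λ v → bit (σ u) * lt u v) + sum (λ v → bit (σ v) * lt u v))
      ≡⟨ ∑-distrib-+ (λ u → sum (λ v → bit (σ u) * lt u v)) (λ u → sum (λ v → bit (σ v) * lt u v)) ⟩
    sum (λ u → sum (λ v → bit (σ u) * lt u v)) + sum (λ u → sum (λ v → bit (σ v) * lt u v))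
      ≡⟨ cong (sum (λ u → sum (λ v → bit (σ u) * lt u v)) +_) (∑-comm (λ u v → bit (σ v) * lt u v)) ⟩
    sum (λ u → sum (λ v → bit (σ u) * lt u v)) + sum (λ u → sum (λ v → bit (σ u) * lt v u))
      ≡⟨ ∑-distrib-+ (λ u → sum (λ v → bit (σ u) * lt u v)) (λ u → sum (λ v → bit (σ u) * lt v u)) ⟨
    sum (λ u → sum (λ v → bit (σ u) * lt u v) + sum (λ v → bit (σ u) * lt v u))
      ≡⟨ sum-cong-≗ (λ u → ∑-distrib-+ (λ v → bit (σ u) * lt u v) (λ v → bit (σ u) * lt v u)) ⟨
    sum (λ u → sum (λ v → bit (σ u) * lt u v + bit (σ u) * lt v u))
      ≤⟨ sum-mono (λ u → sum-mono (λ v → both u v)) ⟩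
    sum (λ u → sum {N} (λ v → bit (σ u)))
      ≡⟨ sum-cong-≗ (λ u → trans (sum-const N (bit (σ u))) (*-comm N _)) ⟩
    sum (λ u → bit (σ u) * N)
      ≡⟨ sum-*ʳ (bit ∘ σ) N ⟩
    sum (bit ∘ σ) * N ∎
    where
    open ≤-Reasoning
    lt : Fin N → Fin N → ℕ
    lt u v = bit (toℕ u <ᵇ toℕ v)
    cell : ∀ u v → bit ((toℕ u <ᵇ toℕ v) ∧ (adj H u v ∧ (σ u ∨ σ v)))
                   ≤ bit (σ u) * lt u v + bit (σ v) * lt u v
    cell u v = begin
      bit ((toℕ u <ᵇ toℕ v) ∧ (adj H u v ∧ (σ u ∨ σ v)))
        ≤⟨ bit-mono (λ h → let l , r = ∧-elim {toℕ u <ᵇ toℕ v} h in ∧-intro l (proj₂ (∧-elim {adj H u v} r))) ⟩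
      bit ((toℕ u <ᵇ toℕ v) ∧ (σ u ∨ σ v))     ≡⟨ bit-∧ (toℕ u <ᵇ toℕ v) _ ⟩
      bit (σ u ∨ σ v) * lt u v                 ≤⟨ *-monoˡ-≤ (lt u v) (bit-∨ (σ u) (σ v)) ⟩
      (bit (σ u) + bit (σ v)) * lt u v         ≡⟨ *-distribʳ-+ (lt u v) (bit (σ u)) (bit (σ v)) ⟩
      bit (σ u) * lt u v + bit (σ v) * lt u v  ∎
    both : ∀ u v → bit (σ u) * lt u v + bit (σ u) * lt v u ≤ bit (σ u)
    both u v = begin
      bit (σ u) * lt u v + bit (σ u) * lt v u  ≡⟨ *-distribˡ-+ (bit (σ u)) (lt u v) (lt v u) ⟨
      bit (σ u) * (lt u v + lt v u)            ≤⟨ *-monoʳ-≤ (bit (σ u)) (<ᵇ-or-≥ᵇ (toℕ u) (toℕ v)) ⟩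
      bit (σ u) * 1                            ≡⟨ *-identityʳ _ ⟩
      bit (σ u)                                ∎

  -- The vertices of `σ` become isolated, and the others are pairwise adjacent by hypothesis, so the
  -- clusters are singletons and one clique.
  incident-isClusterDeletionSet :
    (∀ {u v} → u ≢ v → ¬ T (σ u) → ¬ T (σ v) → Adj H u v) → IsClusterDeletionSet H incident
  incident-isClusterDeletionSet complete =
    (λ u v → proj₁ ∘ ∧-elim) , λ u {v} {w} uv uw v≢w → clique v≢w (path uv) (path uw)
    where
    D = H ∖ᴱ incident

    edge : ∀ {u v} → Adj D u v → ¬ T (σ u) × ¬ T (σ v)
    edge {u} {v} uv with ∧-elim {adj H u v} uv
    ... | h , r = (λ s → T-not r (∧-intro h (∨-introˡ s)))
                , (λ s → T-not r (∧-intro h (∨-introʳ {σ u} s)))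

    path : ∀ {u v} → Star (Adj D) u v → u ≡ v ⊎ ¬ T (σ u) × ¬ T (σ v)
    path ε = inj₁ refl
    path (uw ◅ rest) with edge uw | path rest
    ... | nu , nw | inj₁ refl     = inj₂ (nu , nw)
    ... | nu , _  | inj₂ (_ , nv) = inj₂ (nu , nv)

    kept : ∀ {v w} → v ≢ w → ¬ T (σ v) → ¬ T (σ w) → Adj D v w
    kept {v} {w} v≢w nv nw = ∧-intro (complete v≢w nv nw)
      (not-T (λ h → [ nv , nw ]′ (∨-elim (proj₂ (∧-elim {adj H v w} h)))))

    clique : ∀ {u v w} → v ≢ w → u ≡ v ⊎ ¬ T (σ u) × ¬ T (σ v) →
             u ≡ w ⊎ ¬ T (σ u) × ¬ T (σ w) → Adj D v w
    clique v≢w (inj₁ refl)     (inj₁ refl)     = contradiction refl v≢w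
    clique v≢w (inj₁ refl)     (inj₂ (nv , nw)) = kept v≢w nv nw
    clique v≢w (inj₂ (nw , nv)) (inj₁ refl)    = kept v≢w nv nw
    clique v≢w (inj₂ (_ , nv)) (inj₂ (_ , nw)) = kept v≢w nv nw

-- The averaging argument: edges from the first `m` vertices to the rest are counted at their larger
-- end, so rows of different `x` count different edges. `edgeCount` counts at the smaller end,
-- whence the exchange of sums.
edgeCount-above : ∀ {m N a} (m≤N : m ≤ N) (E : Graph N) →
                  (∀ x → m ≤ toℕ x → a ≤ sum {m} (λ u → bit (adj E x (inject≤ u m≤N)))) →
                  (N ∸ m) * a ≤ edgeCount E
edgeCount-above {m} {N} {a} m≤N E a≤row = begin
  (N ∸ m) * a                                                         ≤⟨ sum-above m _ above ⟩
  sum (λ x → sum (λ u → bit ((toℕ u <ᵇ toℕ x) ∧ adj E u x)))            ≡⟨ ∑-comm (λ x u → bit ((toℕ u <ᵇ toℕ x) ∧ adj E u x)) ⟩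
  edgeCount E                                                         ∎
  where
  open ≤-Reasoning
  above : ∀ x → m ≤ toℕ x → a ≤ sum (λ u → bit ((toℕ u <ᵇ toℕ x) ∧ adj E u x))
  above x m≤x = begin
    a                                                   ≤⟨ a≤row x m≤x ⟩
    sum {m} (λ u → bit (adj E x (inject≤ u m≤N)))         ≤⟨ sum-mono (λ u → bit-mono (cell u)) ⟩
    sum {m} (λ u → bit ((toℕ (inject≤ u m≤N) <ᵇ toℕ x) ∧ adj E (inject≤ u m≤N) x))
      ≤⟨ sum-inject≤ m≤N (λ u → bit ((toℕ u <ᵇ toℕ x) ∧ adj E u x)) ⟩
    sum (λ u → bit ((toℕ u <ᵇ toℕ x) ∧ adj E u x))        ∎
    where
    cell : ∀ u → T (adj E x (inject≤ u m≤N)) → T ((toℕ (inject≤ u m≤N) <ᵇ toℕ x) ∧ adj E (inject≤ u m≤N) x)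
    cell u e = ∧-intro
      (<⇒<ᵇ (subst (_< toℕ x) (sym (toℕ-inject≤ u m≤N)) (<-≤-trans (toℕ<n u) m≤x)))
      (subst T (Graph.sym E x _) e)

module _ (Π : MinimisationProblem) where
  open MinimisationProblem Π

  -- The least number principle for a predicate that is not decided: if no size were minimal,
  -- well-founded induction would exclude every size.
  ¬¬minimum : ∀ {n} (G : Graph n) {S} → Feasible G S → ¬ ¬ ∃ (IsMinimumSize G)
  ¬¬minimum G {S} ok none = <-rec (λ k → ∀ S → Feasible G S → size S ≢ k) smallest _ S ok refl
    where
    smallest : ∀ k → (∀ {l} → l < k → ∀ S → Feasible G S → size S ≢ l) → ∀ S → Feasible G S → size S ≢ k
    smallest k smaller S ok refl =
      none (k , (S , ok , refl) , λ S′ ok′ → ≮⇒≥ (λ lt → smaller lt S′ ok′ refl))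

-- Subsets and adjacency indexed by natural numbers, empty out of range

contains : ∀ {n} → Subset n → ℕ → Bool
contains []      _       = false
contains (b ∷ _) zero    = b
contains (_ ∷ S) (suc i) = contains S i

contains-toℕ : ∀ {n} (S : Subset n) u → contains S (toℕ u) ≡ lookup S u
contains-toℕ (_ ∷ S) zero    = refl
contains-toℕ (_ ∷ S) (suc u) = contains-toℕ S u

sum-contains : ∀ {n N} → n ≤ N → (S : Subset n) → sum {N} (bit ∘ contains S ∘ toℕ) ≡ ∣ S ∣
sum-contains {N = N} _ []                = trans (sum-const N 0) (*-zeroʳ N)
sum-contains (s≤s n≤N) (inside  ∷ S) = cong suc (sum-contains n≤N S)
sum-contains (s≤s n≤N) (outside ∷ S) = sum-contains n≤N S

-- Total on natural numbers, so that the larger gadget and the loop counters of the machine can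
-- refer to `G` without coercions.
extend : ∀ {n} → Graph n → ℕ → ℕ → Bool
extend {n} G i j with i <? n | j <? n
... | yes i<n | yes j<n = adj G (fromℕ< i<n) (fromℕ< j<n)
... | _       | _       = false

extend-toℕ : ∀ {n} (G : Graph n) u v → extend G (toℕ u) (toℕ v) ≡ adj G u v
extend-toℕ {n} G u v with toℕ u <? n | toℕ v <? n
... | yes p | yes q = cong₂ (adj G) (fromℕ<-toℕ u p) (fromℕ<-toℕ v q)
... | no ¬p | _     = contradiction (toℕ<n u) ¬p
... | yes _ | no ¬q = contradiction (toℕ<n v) ¬q

extend-elim : ∀ {n} (G : Graph n) {i j} → T (extend G i j) → ∃₂ λ u v → toℕ u ≡ i × toℕ v ≡ j × Adj G u v
extend-elim {n} G {i} {j} e with i <? n | j <? n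
... | yes p | yes q = _ , _ , toℕ-fromℕ< p , toℕ-fromℕ< q , e

extend-sym : ∀ {n} (G : Graph n) i j → extend G i j ≡ extend G j i
extend-sym {n} G i j with i <? n | j <? n
... | yes _ | yes _ = Graph.sym G _ _
... | yes _ | no  _ = refl
... | no  _ | yes _ = refl
... | no  _ | no  _ = refl

-- The complement, on N vertices, of the edges of G that avoid w

survives : ∀ {n} → Graph n → ℕ → ℕ → ℕ → Bool
survives G w i j = not (i ≡ᵇ w) ∧ not (j ≡ᵇ w) ∧ extend G i j

gadgetAdj : ∀ {n} → Graph n → ℕ → ℕ → ℕ → Bool
gadgetAdj G w i j = not (i ≡ᵇ j) ∧ not (survives G w i j)

survives-sym : ∀ {n} (G : Graph n) w i j → survives G w i j ≡ survives G w j i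
survives-sym G w i j rewrite extend-sym G i j with i ≡ᵇ w | j ≡ᵇ w
... | false | false = refl
... | false | true  = refl
... | true  | false = refl
... | true  | true  = refl

-- The vertex `w` is not removed but stripped of its edges, which preserves the numbering. In the
-- complement `w` and the padding vertices are adjacent to all others.
gadget : ∀ {n} → Graph n → ℕ → ∀ N → Graph N
gadget G w N = record
  { adj    = λ u v → gadgetAdj G w (toℕ u) (toℕ v)
  ; sym    = λ u v → cong₂ (λ a b → not a ∧ not b) (≡ᵇ-sym (toℕ u) (toℕ v)) (survives-sym G w (toℕ u) (toℕ v))
  ; irrefl = λ u → cong (λ b → not b ∧ not (survives G w (toℕ u) (toℕ u))) (≡ᵇ-refl (toℕ u))
  }

-- From deletion sets of the gadget to covers, and back

module _ {n N} (n≤N : n ≤ N) (G : Graph n) (w : Fin n) where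

  private
    H : Graph N
    H = gadget G (toℕ w) N

    ι : Fin n → Fin N
    ι u = inject≤ u n≤N

    gadget-intro : ∀ {u v} → u ≢ v → ¬ T (survives G (toℕ w) (toℕ u) (toℕ v)) → Adj H u v
    gadget-intro u≢v ¬s = ∧-intro (not-T (λ e → u≢v (toℕ-injective (≡ᵇ⇒≡ _ _ e)))) (not-T ¬s)

  module _ (E : Graph N) where

    rowSum : Fin N → ℕ
    rowSum x = sum {n} (λ u → bit (adj E x (ι u)))

    rowCover : Fin N → Subset n
    rowCover x = tabulate (λ u → adj E x (ι u) ∨ (toℕ u ≡ᵇ toℕ w))

    rowCover-size : ∀ x → ∣ rowCover x ∣ ≤ suc (rowSum x)
    rowCover-size x = begin
      ∣ rowCover x ∣                                     ≡⟨ ∣∣≡sum (rowCover x) ⟩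
      sum (λ u → bit (lookup (rowCover x) u))            ≡⟨ sum-cong-≗ {n} (λ u → cong bit (lookup∘tabulate (λ u → adj E x (ι u) ∨ (toℕ u ≡ᵇ toℕ w)) u)) ⟩
      sum (λ u → bit (adj E x (ι u) ∨ (toℕ u ≡ᵇ toℕ w)))  ≤⟨ sum-mono {n} (λ u → bit-∨ (adj E x (ι u)) _) ⟩
      sum (λ u → bit (adj E x (ι u)) + bit (toℕ u ≡ᵇ toℕ w)) ≡⟨ ∑-distrib-+ {n} (λ u → bit (adj E x (ι u))) _ ⟩
      rowSum x + sum {n} (λ u → bit (toℕ u ≡ᵇ toℕ w))         ≡⟨ cong (rowSum x +_) (sum-indicator w) ⟩
      rowSum x + 1                                       ≡⟨ +-comm (rowSum x) 1 ⟩
      suc (rowSum x)                                     ∎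
      where open ≤-Reasoning

    -- Otherwise u and v would lie in the cluster of x, although they are not adjacent in the gadget.
    rowCover-isVertexCover : IsClusterDeletionSet H E → ∀ x → n ≤ toℕ x → IsVertexCover G (rowCover x)
    rowCover-isVertexCover (_ , clusters) x n≤x u v uv
      with T? (adj E x (ι u) ∨ (toℕ u ≡ᵇ toℕ w)) | T? (adj E x (ι v) ∨ (toℕ v ≡ᵇ toℕ w))
    ... | yes p | _     = inj₁ (T⇒∈ (subst T (sym (lookup∘tabulate _ u)) p))
    ... | no _  | yes q = inj₂ (T⇒∈ (subst T (sym (lookup∘tabulate _ v)) q))
    ... | no ¬p | no ¬q = contradiction survives-uv (T-not (proj₂ (∧-elim {not (toℕ (ι u) ≡ᵇ toℕ (ι v))} (proj₁ (∧-elim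
            (clusters x (kept u ¬p ◅ ε) (kept v ¬q ◅ ε) ιu≢ιv))))))
      where
      ιu≢ιv : ι u ≢ ι v
      ιu≢ιv eq with refl ← inject≤-injective n≤N n≤N u v eq = subst T (Graph.irrefl G u) uv

      survives-uv : T (survives G (toℕ w) (toℕ (ι u)) (toℕ (ι v)))
      survives-uv rewrite toℕ-inject≤ u n≤N | toℕ-inject≤ v n≤N | extend-toℕ G u v =
        ∧-intro (not-T (¬p ∘ ∨-introʳ {adj E x (ι u)})) (∧-intro (not-T (¬q ∘ ∨-introʳ {adj E x (ι v)})) uv)

      -- The padding vertex `x` is adjacent to every other vertex of the gadget, so only `E` can
      -- remove its edge to `u`.
      kept : ∀ u → ¬ T (adj E x (ι u) ∨ (toℕ u ≡ᵇ toℕ w)) → Adj (H ∖ᴱ E) x (ι u)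
      kept u ¬p = ∧-intro
        (gadget-intro (λ eq → <⇒≱ (toℕ<n u) (subst (n ≤_) (trans (cong toℕ eq) (toℕ-inject≤ u n≤N)) n≤x))
          (λ s → let i , _ , eq , _ = extend-elim G (proj₂ (∧-elim {not (toℕ (ι u) ≡ᵇ toℕ w)} (proj₂ (∧-elim {not (toℕ x ≡ᵇ toℕ w)} s))))
                 in <⇒≱ (toℕ<n i) (subst (n ≤_) (sym eq) n≤x)))
        (not-T (¬p ∘ ∨-introˡ))

  module _ {S : Subset n} (cover : IsVertexCover G S) (w∈S : w ∈ S) where

    private
      σ : Fin N → Bool
      σ u = contains S (toℕ u) ∧ not (toℕ u ≡ᵇ toℕ w)

    -- Surviving edges avoid `w`, so `S` without `w` covers them and the gadget is complete outside
    -- that set. Leaving out `w` makes `t` strictly smaller than the size of `S`.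
    gadget-solution : ∃ λ E → ∃ λ t → IsClusterDeletionSet H E × edgeCount E ≤ t * N × suc t ≤ ∣ S ∣
    gadget-solution = incident H σ , sum (bit ∘ σ)
                    , incident-isClusterDeletionSet H σ complete , incident-count H σ , small
      where
      covered : ∀ {u v} → T (survives G (toℕ w) (toℕ u) (toℕ v)) → T (σ u) ⊎ T (σ v)
      covered {u} {v} s with ∧-elim {not (toℕ u ≡ᵇ toℕ w)} s
      ... | u≢w , s′ with ∧-elim {not (toℕ v ≡ᵇ toℕ w)} s′
      ...   | v≢w , e with extend-elim G e
      ...     | u′ , v′ , eu , ev , uv with cover u′ v′ uv
      ...       | inj₁ u∈S = inj₁ (∧-intro (subst (T ∘ contains S) eu (subst T (sym (contains-toℕ S u′)) (∈⇒T u∈S))) u≢w)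
      ...       | inj₂ v∈S = inj₂ (∧-intro (subst (T ∘ contains S) ev (subst T (sym (contains-toℕ S v′)) (∈⇒T v∈S))) v≢w)

      complete : ∀ {u v} → u ≢ v → ¬ T (σ u) → ¬ T (σ v) → Adj H u v
      complete u≢v nu nv = gadget-intro u≢v (λ s → [ nu , nv ]′ (covered s))

      split : ∀ b c → (T c → T b) → bit c + bit (b ∧ not c) ≡ bit b
      split true  true  f = refl
      split true  false f = refl
      split false false f = refl
      split false true  f with () ← f tt

      small : suc (sum (bit ∘ σ)) ≤ ∣ S ∣
      small = ≤-reflexive (begin
        suc (sum (bit ∘ σ))
          ≡⟨ cong (_+ sum (bit ∘ σ)) (sum-indicator (ι w)) ⟨
        sum {N} (λ u → bit (toℕ u ≡ᵇ toℕ (ι w))) + sum (bit ∘ σ)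
          ≡⟨ cong (λ k → sum {N} (λ u → bit (toℕ u ≡ᵇ k)) + sum (bit ∘ σ)) (toℕ-inject≤ w n≤N) ⟩
        sum {N} (λ u → bit (toℕ u ≡ᵇ toℕ w)) + sum (bit ∘ σ)
          ≡⟨ ∑-distrib-+ {N} (λ u → bit (toℕ u ≡ᵇ toℕ w)) (bit ∘ σ) ⟨
        sum {N} (λ u → bit (toℕ u ≡ᵇ toℕ w) + bit (σ u))
          ≡⟨ sum-cong-≗ {N} (λ u → split (contains S (toℕ u)) (toℕ u ≡ᵇ toℕ w) (λ e →
               subst (T ∘ contains S) (sym (≡ᵇ⇒≡ (toℕ u) (toℕ w) e)) (subst T (sym (contains-toℕ S w)) (∈⇒T w∈S)))) ⟩
        sum {N} (λ u → bit (contains S (toℕ u)))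
          ≡⟨ sum-contains n≤N S ⟩
        ∣ S ∣ ∎)
        where open ≡-Reasoning

-- Averaging bounds the lightest padding row in terms of `edgeCount E`, and the deletion set made
-- from `S` bounds the minimum. Only upper bounds on `b` are assumed, because the value in `best`
-- may stem from the run for the other guess.
guess-correct : ∀ {c D} → Gap D c →
  ∀ {n N} (n≤N : n ≤ N) → suc (suc D) * (n * n) ≡ N →
  (G : Graph n) (w : Fin n) (E : Graph N) →
  (∀ m → MinimisationProblem.IsMinimumSize ClusterDeletion (gadget G (toℕ w) N) m → edgeCount E ≤ c · m) →
  ∀ {b} → (∀ x → n ≤ toℕ x → b ≤ suc (rowSum n≤N G w E x)) →
  ∀ {S} → IsVertexCover G S → w ∈ S → b ≤ c · ∣ S ∣
guess-correct {c} {D} gap {n} {N} n≤N N≡ G w E approx {b} b≤row {S} cover w∈S = ≤·-intro b ∣ S ∣ gap bound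
  where
  open ≤-Reasoning
  H = gadget G (toℕ w) N
  k = N ∸ n
  n≤nn : n ≤ n * n
  -- The guess `w` witnesses that `n` is positive.
  n≤nn = m≤m*n n n {{>-nonZero (≤-trans (s≤s z≤n) (toℕ<n w))}}
  -- The origin of `c′ = D + 2`: at most one of the `D + 2` copies of `n²` is lost to the vertices
  -- of `G`.
  big : suc D * (n * n) ≤ k
  big = begin
    suc D * (n * n)                  ≡⟨ m+n∸m≡n (n * n) _ ⟨
    suc (suc D) * (n * n) ∸ n * n    ≤⟨ ∸-mono (≤-reflexive N≡) n≤nn ⟩
    k                                ∎
  0<k : 0 < k
  0<k = ≤-trans (≤-trans (s≤s z≤n) (toℕ<n w)) (≤-trans n≤nn (≤-trans (m≤m+n (n * n) _) big))

  bound′ : ∀ {P Q} → Exceeds D c P Q → ∀ b → (∀ x → n ≤ toℕ x → b ≤ suc (rowSum n≤N G w E x)) →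
           ∀ m → MinimisationProblem.IsMinimumSize ClusterDeletion H m → b * Q ≤ P * ∣ S ∣
  -- For positive `b` the 1 for the guessed vertex can be split off, leaving a bound on every row
  -- sum.
  bound′ ex zero _ m min = z≤n
  bound′ {P} {Q} ex (suc a) b≤row m min =
    let E* , t , feasible , E*≤ , t<S = gadget-solution n≤N G w cover w∈S in
    ≤-trans
    (absorb {P} {Q} {D} (Exceeds.gap ex) big 0<k (sym (m∸n+n≡m n≤N)) (≤-trans (n≤1+n t) (≤-trans t<S (∣p∣≤n S))) (begin
      k * a * Q        ≤⟨ *-monoˡ-≤ Q (edgeCount-above n≤N E (λ x n≤x → s≤s⁻¹ (b≤row x n≤x))) ⟩
      edgeCount E * Q  ≤⟨ ≤·-elim (edgeCount E) m (approx m min) ex ⟩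
      P * m            ≤⟨ *-monoʳ-≤ P (≤-trans (proj₂ min E* feasible) E*≤) ⟩
      P * (t * N)      ∎))
    (*-monoʳ-≤ P t<S)

  bound : ∀ {P Q} → Exceeds D c P Q → b * Q ≤ P * ∣ S ∣
  -- Decidability of the inequality discharges the double negation on the existence of a minimum.
  bound {P} {Q} ex = decidable-stable (b * Q ≤? P * ∣ S ∣) (λ fails →
    let E* , _ , feasible , _ = gadget-solution n≤N G w cover w∈S in
    ¬¬minimum ClusterDeletion H {E*} feasible (λ (m , min) → fails (bound′ ex b b≤row m min)))

-- The algorithm

rows cols vertices square gadgetOrder guess source target weight best chosen improved found end₁ end₂ test₁ test₂ : Reg
vertices    = 0
rows        = 5
cols        = 6
square      = 16
gadgetOrder = 17
guess       = 18
source      = 19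
target      = 20
weight      = 21
best        = 22
chosen      = 23
improved    = 24
found       = 25
end₁        = 26
end₂        = 27
test₁       = 28
test₂       = 29

-- Registers and arrays of the two copies (k = 0 , 1) of the given algorithm.
copy : ℕ → ℕ → ℕ
copy k x = 32 + (k + 2 * x)

-- The products `n * n` and `c′ * n * n` are counted up by ones, for lack of multiplication.
measure : ℕ → Program
measure c′ =
  ((rows ≔ var vertices) ⨾ (cols ≔ var vertices)) ⨾
  grid skip (square ≔ var square ⊕ lit 1) skip ⨾
  ((rows ≔ var square) ⨾ (cols ≔ lit c′)) ⨾
  grid skip (gadgetOrder ≔ var gadgetOrder ⊕ lit 1) skip

-- `source` is the offset of the current matrix row, advanced by addition. Later edges overwrite
-- earlier ones, as any edge will do.
findEdge : Program
findEdge =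
  ((rows ≔ var vertices) ⨾ (cols ≔ var vertices)) ⨾
  grid skip
       ((test₁ ≔ 0 ! (var source ⊕ col)) ⨾
        ifnz test₁ ((found ≔ lit 1) ⨾ (end₁ ≔ row) ⨾ (end₂ ≔ col)) skip)
       (source ≔ var source ⊕ var vertices)

-- The trivial cover makes the invariant of both runs, that array 1 holds a cover of size at most
-- `best`, true from the start. A single loop is a grid with one row.
allVertices : Program
allVertices =
  ((best ≔ var vertices) ⨾ (rows ≔ lit 1) ⨾ (cols ≔ var vertices)) ⨾
  grid skip (1 [ col ]≔ lit 1) skip

-- Subtraction truncates at 0, so the two differences add up to the distance of the values.
equal : Expr → Expr → Expr
equal e f = lit 1 ⊖ ((e ⊖ f) ⊕ (f ⊖ e))

-- The formula of `gadgetAdj` with `lit 1 ⊖ e` as negation, `⊕` as disjunction and any positive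
-- number as true. The first two terms of the inner sum detect indices outside `G`, for which the
-- matrix entry that is read is meaningless.
gadgetCell : Expr
gadgetCell = lit 1 ⊖ (equal row col ⊕ (lit 1 ⊖
  ((lit 1 ⊖ (var vertices ⊖ row)) ⊕ (lit 1 ⊖ (var vertices ⊖ col)) ⊕
   equal row (var guess) ⊕ equal col (var guess) ⊕ (lit 1 ⊖ 0 ! (var source ⊕ col)))))

buildGadget : Arr → Program
buildGadget a =
  ((rows ≔ var gadgetOrder) ⨾ (cols ≔ var gadgetOrder) ⨾ (source ≔ lit 0) ⨾ (target ≔ lit 0)) ⨾
  grid skip (a [ var target ⊕ col ]≔ gadgetCell)
       ((source ≔ var source ⊕ var vertices) ⨾ (target ≔ var target ⊕ var gadgetOrder))

-- A weight starts at 1 to account for the guessed vertex. `test₁` is nonzero exactly on padding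
-- rows, `test₂` exactly when the row is strictly lighter than `best`, and `chosen` records the
-- offset of the row.
findRow : Arr → Program
findRow a =
  ((rows ≔ var gadgetOrder) ⨾ (cols ≔ var vertices) ⨾ (target ≔ lit 0) ⨾ (improved ≔ lit 0)) ⨾
  grid (weight ≔ lit 1)
       (weight ≔ var weight ⊕ a ! (var target ⊕ col))
       (((test₁ ≔ (row ⊕ lit 1) ⊖ var vertices) ⨾ (test₂ ≔ var best ⊖ var weight)) ⨾
        ifnz test₁ (ifnz test₂ ((best ≔ var weight) ⨾ (chosen ≔ var target) ⨾ (improved ≔ lit 1)) skip) skip ⨾
        (target ≔ var target ⊕ var gadgetOrder))

-- The flag `improved` doubles as the number of rows of the grid, so nothing is copied unless a
-- lighter row was found.
copyRow : Arr → Program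
copyRow a =
  ((rows ≔ var improved) ⨾ (cols ≔ var vertices)) ⨾
  grid skip (1 [ col ]≔ a ! (var chosen ⊕ col)) skip ⨾
  ifnz improved (1 [ var guess ]≔ lit 1) skip

-- `copy k 0` is both the array of the input matrix and the register of its order, and `copy k 1` is
-- the output array, as the renamed program expects.
improve : ℕ → Program → Program
improve k P =
  buildGadget (copy k 0) ⨾ (copy k 0 ≔ var gadgetOrder) ⨾ rename (copy k) P ⨾
  findRow (copy k 1) ⨾ copyRow (copy k 1)

-- A graph without edges offers no vertex to guess; array 1 is then still zero and encodes the empty
-- cover.
approximateCover : ℕ → Program → Program
approximateCover c′ P =
  measure c′ ⨾ findEdge ⨾
  ifnz found (allVertices ⨾ (guess ≔ var end₁) ⨾ improve 0 P ⨾ (guess ≔ var end₂) ⨾ improve 1 P) skip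

-- F bounds one run of the given algorithm and Y one pass over the matrix of the gadget.
module Timed (F Y : ℕ) (1≤Y : 1 ≤ Y) where

  -- A record, so that unification can recover the coefficients `a` and `b`, which it cannot do from
  -- the sum.
  record Runs (p : Program) (s : State) (a b : ℕ) (Q : State → Set) : Set where
    constructor runs
    field
      halts : Halts p s (a * F + b * Y) Q

  exec-runs : ∀ {p} → T (loopFree p) → ∀ {s} {Q : State → Set} → Q (exec p s) → Runs p s 0 (length p) Q
  exec-runs {p} lf q with exec-halts {p} lf q
  ... | t , s′ , p⇓ , t≤ , q′ = runs (t , s′ , p⇓ , ≤-trans t≤ (m≤m*n _ Y {{>-nonZero 1≤Y}}) , q′)

  infixr 4 _then_

  _then_ : ∀ {p q s a b a′ b′} {Q Q′ : State → Set} → Runs p s a b Q →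
           (∀ {s′} → Keeps p s s′ → Q s′ → Runs q s′ a′ b′ Q′) → Runs (p ⨾ q) s (a + a′) (b + b′) Q′
  _then_ {p} {q} {s} {a} {b} {a′} {b′} {Q} {Q′} (runs r) next =
    runs (subst (λ k → Halts (p ⨾ q) s k Q′) eq (seq-halts r (λ k h → Runs.halts (next k h))))
    where
    open +-*-Solver
    eq : (a * F + b * Y) + (a′ * F + b′ * Y) ≡ (a + a′) * F + (b + b′) * Y
    eq = solve 6 (λ a b a′ b′ F Y → (a :* F :+ b :* Y) :+ (a′ :* F :+ b′ :* Y) := (a :+ a′) :* F :+ (b :+ b′) :* Y)
           refl a b a′ b′ F Y

  map-runs : ∀ {p s a b} {Q Q′ : State → Set} → (∀ {s′} → Keeps p s s′ → Q s′ → Q′ s′) →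
             Runs p s a b Q → Runs p s a b Q′
  map-runs f (runs (t , s′ , p⇓ , t≤ , q)) = runs (t , s′ , p⇓ , t≤ , f (keeps p⇓) q)

  -- Rounds a computed cost up to a convenient numeral; the comparison is checked by evaluation. The
  -- numerals 100, 200 and so on below are such generous bounds.
  within : ∀ {p s a b} {Q : State → Set} b′ → T (b ≤ᵇ b′) → Runs p s a b Q → Runs p s a b′ Q
  within {a = a} {b} b′ b≤b′ (runs (t , s′ , p⇓ , t≤ , q)) =
    runs (t , s′ , p⇓ , ≤-trans t≤ (+-monoʳ-≤ (a * F) (*-monoˡ-≤ Y (≤ᵇ⇒≤ b b′ b≤b′))) , q)

  relax : ∀ {p s a b} {Q : State → Set} a′ b′ → T (a ≤ᵇ a′) → T (b ≤ᵇ b′) → Runs p s a b Q → Runs p s a′ b′ Q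
  relax {a = a} {b} a′ b′ a≤a′ b≤b′ (runs (t , s′ , p⇓ , t≤ , q)) = runs (t , s′ , p⇓ ,
    ≤-trans t≤ (+-mono-≤ (*-monoˡ-≤ F (≤ᵇ⇒≤ a a′ a≤a′)) (*-monoˡ-≤ Y (≤ᵇ⇒≤ b b′ b≤b′))) , q)

  private
    one-more : ∀ a b {t} → t ≤ a * F + b * Y → suc t ≤ a * F + suc b * Y
    one-more a b {t} t≤ = begin
      1 + t                 ≤⟨ +-mono-≤ 1≤Y t≤ ⟩
      Y + (a * F + b * Y)   ≡⟨ +-assoc Y (a * F) (b * Y) ⟨
      (Y + a * F) + b * Y   ≡⟨ cong (_+ b * Y) (+-comm Y (a * F)) ⟩
      (a * F + Y) + b * Y   ≡⟨ +-assoc (a * F) Y (b * Y) ⟩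
      a * F + suc b * Y     ∎
      where open ≤-Reasoning

  ifnz-runs : ∀ {x p q s a b} {Q : State → Set} → reg s x ≢ 0 → Runs p s a b Q → Runs (ifnz x p q) s a (suc b) Q
  ifnz-runs {a = a} {b} x≢0 (runs (t , s′ , p⇓ , t≤ , q)) = runs (_ , s′ , ifnz⇓ x≢0 p⇓ , one-more a b t≤ , q)

  ifz-runs : ∀ {x p q s a b} {Q : State → Set} → reg s x ≡ 0 → Runs q s a b Q → Runs (ifnz x p q) s a (suc b) Q
  ifz-runs {a = a} {b} x≡0 (runs (t , s′ , q⇓ , t≤ , q)) = runs (_ , s′ , ifz⇓ x≡0 q⇓ , one-more a b t≤ , q)

  grid-runs : ∀ {before cell after} → SparesCounters before → SparesCounters cell → SparesCounters after →
    ∀ {R M s₀} → R * M ≤ Y → R ≤ Y → reg s₀ rows ≡ R → reg s₀ cols ≡ M →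
    (I : ℕ → State → Set) (J : ℕ → ℕ → State → Set) →
    I 0 (exec gridStart s₀) →
    (∀ {i} s → i < R → reg s 1 ≡ i → Keeps (grid before cell after) s₀ s →
     I i s → J i 0 (exec (before ⨾ rowStart) s)) →
    (∀ {i j} s → i < R → j < M → reg s 1 ≡ i → reg s 3 ≡ j → Keeps (grid before cell after) s₀ s →
     J i j s → J i (suc j) (exec (cell ⨾ colEnd) s)) →
    (∀ {i} s → i < R → reg s 1 ≡ i → Keeps (grid before cell after) s₀ s →
     J i M s → I (suc i) (exec (after ⨾ rowEnd) s)) →
    Runs (grid before cell after) s₀ 0 (gridCost before cell after) (I R)
  grid-runs {before} {cell} {after} ub uc ua {R} RM≤Y R≤Y eqR eqM I J start row-start step row-end =
    forget (grid-halts ub uc ua eqR eqM I J start row-start step row-end RM≤Y R≤Y 1≤Y)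
    where
    forget : ∀ {p s k} → Halts p s (k * Y) (λ s′ → Keeps p s s′ × I R s′) → Runs p s 0 k (I R)
    forget (t , s′ , g⇓ , t≤ , _ , inv) = runs (t , s′ , g⇓ , t≤ , inv)

ifnz-exec : ∀ {x p q s} (Q : State → Set) → (reg s x ≢ 0 → Q (exec p s)) → (reg s x ≡ 0 → Q (exec q s)) →
            Q (exec (ifnz x p q) s)
ifnz-exec {x} {p} {q} {s} Q yes-case no-case with reg s x ≡ᵇ 0 in eq
... | true  = no-case (≡ᵇ⇒≡ _ 0 (subst T (sym eq) tt))
... | false = yes-case (λ z → subst T (trans (cong (_≡ᵇ 0) (sym z)) eq) tt)

-- Arithmetic of the gadget

1∸bit : ∀ b → 1 ∸ bit b ≡ bit (not b)
1∸bit true  = refl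
1∸bit false = refl

equalᴺ : ℕ → ℕ → ℕ
equalᴺ i j = 1 ∸ ((i ∸ j) + (j ∸ i))

equalᴺ≡bit : ∀ i j → equalᴺ i j ≡ bit (i ≡ᵇ j)
equalᴺ≡bit zero    zero    = refl
equalᴺ≡bit zero    (suc j) = 0∸n≡0 j
equalᴺ≡bit (suc i) zero    = 0∸n≡0 (i + 0)
equalᴺ≡bit (suc i) (suc j) = equalᴺ≡bit i j

gadgetCellᴺ : (n w i j a : ℕ) → ℕ
gadgetCellᴺ n w i j a = 1 ∸ (equalᴺ i j + (1 ∸
  ((1 ∸ (n ∸ i)) + (1 ∸ (n ∸ j)) + equalᴺ i w + equalᴺ j w + (1 ∸ a))))

extend-outˡ : ∀ {n} (G : Graph n) {i} j → ¬ i < n → extend G i j ≡ false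
extend-outˡ {n} G {i} j i≮n with i <? n | j <? n
... | yes i<n | _ = contradiction i<n i≮n
... | no _    | _ = refl

extend-outʳ : ∀ {n} (G : Graph n) i {j} → ¬ j < n → extend G i j ≡ false
extend-outʳ G i {j} j≮n = trans (extend-sym G i j) (extend-outˡ G i j≮n)

-- The entry `a` is known only inside the matrix. Outside, one of the first two summands is 1, and
-- truncated subtraction yields 0 whatever was read.
survivesᴺ : ∀ {n} (G : Graph n) w i j {a} → (i < n → j < n → a ≡ bit (extend G i j)) →
            1 ∸ ((1 ∸ (n ∸ i)) + (1 ∸ (n ∸ j)) + equalᴺ i w + equalᴺ j w + (1 ∸ a)) ≡ bit (survives G w i j)
survivesᴺ {n} G w i j {a} read with <-≤-connex i n | <-≤-connex j n
... | inj₂ n≤i | _ rewrite m≤n⇒m∸n≡0 n≤i | extend-outˡ G j (≤⇒≯ n≤i)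
                         | ∧-zeroʳ (not (j ≡ᵇ w)) | ∧-zeroʳ (not (i ≡ᵇ w))
  = 0∸n≡0 ((1 ∸ (n ∸ j)) + equalᴺ i w + equalᴺ j w + (1 ∸ a))
... | inj₁ i<n | inj₂ n≤j rewrite m≤n⇒m∸n≡0 n≤j | extend-outʳ G i (≤⇒≯ n≤j)
                         | ∧-zeroʳ (not (j ≡ᵇ w)) | ∧-zeroʳ (not (i ≡ᵇ w)) | +-comm (1 ∸ (n ∸ i)) 1
  = 0∸n≡0 ((1 ∸ (n ∸ i)) + equalᴺ i w + equalᴺ j w + (1 ∸ a))
... | inj₁ i<n | inj₁ j<n rewrite read i<n j<n | equalᴺ≡bit i w | equalᴺ≡bit j w
                      | m≤n⇒m∸n≡0 (m<n⇒0<n∸m i<n) | m≤n⇒m∸n≡0 (m<n⇒0<n∸m j<n)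
  with i ≡ᵇ w | j ≡ᵇ w | extend G i j
...     | true  | b     | e     = 0∸n≡0 (bit b + (1 ∸ bit e))
...     | false | true  | e     = 0∸n≡0 (1 ∸ bit e)
...     | false | false | true  = refl
...     | false | false | false = refl

gadgetCellᴺ≡bit : ∀ {n} (G : Graph n) w i j {a} → (i < n → j < n → a ≡ bit (extend G i j)) →
                  gadgetCellᴺ n w i j a ≡ bit (gadgetAdj G w i j)
gadgetCellᴺ≡bit G w i j read rewrite survivesᴺ G w i j read | equalᴺ≡bit i j with i ≡ᵇ j
... | true  = 0∸n≡0 (bit (survives G w i j))
... | false = 1∸bit (survives G w i j)

-- Row-major indices

index-< : ∀ {N i j i′} j′ → j < N → i < i′ → i * N + j < i′ * N + j′
index-< {N} {i} {j} {i′} j′ j<N i<i′ = begin-strict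
  i * N + j   <⟨ +-monoʳ-< (i * N) j<N ⟩
  i * N + N   ≡⟨ +-comm (i * N) N ⟩
  suc i * N   ≤⟨ *-monoˡ-≤ N i<i′ ⟩
  i′ * N      ≤⟨ m≤m+n (i′ * N) j′ ⟩
  i′ * N + j′ ∎
  where open ≤-Reasoning

index-injective : ∀ {N} i {j} i′ {j′} → j < N → j′ < N → i * N + j ≡ i′ * N + j′ → i ≡ i′ × j ≡ j′
index-injective {N} i {j} i′ {j′} j<N j′<N eq with <-cmp i i′
... | tri≈ _ refl _ = refl , +-cancelˡ-≡ (i * N) j j′ eq
... | tri< i<i′ _ _ = contradiction eq (<⇒≢ (index-< j′ j<N i<i′))
... | tri> _ _ i′<i = contradiction (sym eq) (<⇒≢ (index-< j j′<N i′<i))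

matrix-entry : ∀ {n} (G : Graph n) a → HoldsMatrix a (adj G) → ∀ {i j} → i < n → j < n →
               a (i * n + j) ≡ bit (extend G i j)
matrix-entry {n} G a holds {i} {j} i<n j<n
  with fromℕ< i<n | toℕ-fromℕ< i<n | fromℕ< j<n | toℕ-fromℕ< j<n
... | u | refl | v | refl = trans (holds u v) (cong bit (sym (extend-toℕ G u v)))

bit≡0 : ∀ {b} → bit b ≡ 0 → b ≡ false
bit≡0 {false} _ = refl

-- The common induction step of the loops that fill an array from left to right.
store-next : ∀ (P : ℕ → ℕ → Set) {f : ℕ → ℕ} {j k v} → k ≡ j → P j v → (∀ i → i < j → P i (f i)) →
             ∀ i → i < suc j → P i ((f [ k ↦ v ]) i)
store-next P {f} {j} {k} {v} refl new old i i≤j with i ≡ᵇ k in eq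
... | true  = subst (λ i → P i v) (sym (≡ᵇ⇒≡ i k (subst T (sym eq) tt))) new
... | false with m≤n⇒m<n∨m≡n (s≤s⁻¹ i≤j)
...   | inj₁ i<j  = old i i<j
...   | inj₂ refl with () ← trans (sym (≡ᵇ-refl k)) eq

∸≢0⇒< : ∀ m n → m ∸ n ≢ 0 → n < m
∸≢0⇒< m n h with <-≤-connex n m
... | inj₁ n<m = n<m
... | inj₂ m≤n = contradiction (m≤n⇒m∸n≡0 m≤n) h

-- The subroutines

module Subroutines (F N : ℕ) {n : ℕ} (n≤N : n ≤ N) (G : Graph n) where

  -- `suc N` keeps `Y` positive for the graph without vertices, so that constant costs can be
  -- charged to it.
  Y : ℕ
  Y = suc N * suc N

  open Timed F Y (s≤s z≤n)

  fits : ∀ {R M} → R ≤ suc N → M ≤ suc N → R * M ≤ Y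
  fits = *-mono-≤

  fits₁ : ∀ {R} → R ≤ suc N → R ≤ Y
  fits₁ R≤ = ≤-trans R≤ (m≤m*n (suc N) (suc N))

  n≤1+N : n ≤ suc N
  n≤1+N = m≤n⇒m≤1+n n≤N

  measure-runs : ∀ c′ {s} → n * n ≤ N → (n * n) * c′ ≡ N →
    reg s vertices ≡ n → reg s square ≡ 0 → reg s gadgetOrder ≡ 0 →
    Runs (measure c′) s 0 100 (λ s′ → reg s′ gadgetOrder ≡ N)
  measure-runs c′ nn≤N nnc≡N order sq≡0 go≡0 = within 100 tt (
    exec-runs {(rows ≔ var vertices) ⨾ (cols ≔ var vertices)} tt
      {Q = λ s → reg s rows ≡ n × reg s cols ≡ n × reg s square ≡ 0 × reg s gadgetOrder ≡ 0}
      (order , order , sq≡0 , go≡0)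
    then λ _ (r , c , sq , go) → grid-runs safe safe safe
      (fits n≤1+N n≤1+N) (fits₁ n≤1+N) r c
      (λ i s → reg s square ≡ i * n) (λ i j s → reg s square ≡ i * n + j) sq
      (λ _ _ _ _ h → trans h (sym (+-identityʳ _)))
      (λ {i} {j} _ _ _ _ _ _ h → increment (i * n) j h)
      (λ {i} _ _ _ _ h → trans h (+-comm (i * n) n))
    then λ k sq → exec-runs {(rows ≔ var square) ⨾ (cols ≔ lit c′)} tt
      {Q = λ s → reg s rows ≡ n * n × reg s cols ≡ c′ × reg s gadgetOrder ≡ 0}
      (sq , refl , trans (reg-kept k gadgetOrder refl) go)
    then λ _ (r , c , go) → map-runs (λ _ h → trans h nnc≡N)
      (grid-runs safe safe safe
      -- `fits` is no help here, since `c′` may exceed `suc N` when `n` is 0; but the number of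
      -- cells is exactly `N`.
      (≤-trans (≤-reflexive nnc≡N) (≤-trans (n≤1+n N) (m≤m*n (suc N) (suc N)))) (fits₁ (m≤n⇒m≤1+n nn≤N)) r c
      (λ i s → reg s gadgetOrder ≡ i * c′) (λ i j s → reg s gadgetOrder ≡ i * c′ + j) go
      (λ _ _ _ _ h → trans h (sym (+-identityʳ _)))
      (λ {i} {j} _ _ _ _ _ _ h → increment (i * c′) j h)
      (λ {i} _ _ _ _ h → trans h (+-comm (i * c′) c′))))
    where
    increment : ∀ m j {x} → x ≡ m + j → x + 1 ≡ m + suc j
    increment m j refl = trans (+-assoc m j 1) (cong (m +_) (+-comm j 1))

  Found : (i j flag u₁ u₂ : ℕ) → Set
  Found i j flag u₁ u₂ =
    (flag ≡ 0 × (∀ i′ j′ → i′ < i → j′ < n → extend G i′ j′ ≡ false)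
              × (∀ j′ → j′ < j → extend G i j′ ≡ false))
    ⊎ (flag ≢ 0 × ∃₂ λ u v → u₁ ≡ toℕ u × u₂ ≡ toℕ v × Adj G u v)

  EdgeFound : (flag u₁ u₂ : ℕ) → Set
  EdgeFound flag u₁ u₂ = (flag ≡ 0 × (∀ u v → ¬ Adj G u v))
                       ⊎ (flag ≢ 0 × ∃₂ λ u v → u₁ ≡ toℕ u × u₂ ≡ toℕ v × Adj G u v)

  module _ where
    private
      new-edge : ∀ {i j x y} → bit (extend G i j) ≢ 0 → x ≡ i → y ≡ j → ∃₂ λ u v → x ≡ toℕ u × y ≡ toℕ v × Adj G u v
      new-edge {i} {j} nz refl refl with extend G i j in eq
      ... | false = contradiction refl nz
      ... | true  = let u , v , eu , ev , uv = extend-elim G (subst T (sym eq) tt) in u , v , sym eu , sym ev , uv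

      no-edge : ∀ {i j f x y} → Found i j f x y → bit (extend G i j) ≡ 0 → Found i (suc j) f x y
      no-edge (inj₂ e) _ = inj₂ e
      no-edge {i} {j} (inj₁ (z , above , left)) none = inj₁ (z , above , left′)
        where
        left′ : ∀ j′ → j′ < suc j → extend G i j′ ≡ false
        left′ j′ j′≤j with m≤n⇒m<n∨m≡n (s≤s⁻¹ j′≤j)
        ... | inj₁ j′<j = left j′ j′<j
        ... | inj₂ refl = bit≡0 none

      next-row : ∀ {i f x y} → Found i n f x y → Found (suc i) 0 f x y
      next-row (inj₂ e) = inj₂ e
      next-row {i} (inj₁ (z , above , left)) = inj₁ (z , above′ , λ _ ())
        where
        above′ : ∀ i′ j′ → i′ < suc i → j′ < n → extend G i′ j′ ≡ false
        above′ i′ j′ i′≤i j′<n with m≤n⇒m<n∨m≡n (s≤s⁻¹ i′≤i)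
        ... | inj₁ i′<i = above i′ j′ i′<i j′<n
        ... | inj₂ refl = left j′ j′<n

      all-rows : ∀ {f x y} → Found n 0 f x y → EdgeFound f x y
      all-rows (inj₂ e) = inj₂ e
      all-rows (inj₁ (z , above , _)) = inj₁ (z , λ u v uv →
        subst T (trans (sym (extend-toℕ G u v)) (above (toℕ u) (toℕ v) (toℕ<n u) (toℕ<n v))) uv)

      Inv : ℕ → ℕ → State → Set
      Inv i j s = reg s source ≡ i * n × Found i j (reg s found) (reg s end₁) (reg s end₂)

    findEdge-runs : ∀ {s} → reg s vertices ≡ n → HoldsMatrix (mem s 0) (adj G) →
      reg s source ≡ 0 → reg s found ≡ 0 →
      Runs findEdge s 0 100 (λ s → EdgeFound (reg s found) (reg s end₁) (reg s end₂))
    findEdge-runs {s} order matrix src≡0 found≡0 = within 100 tt (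
      exec-runs {(rows ≔ var vertices) ⨾ (cols ≔ var vertices)} tt
        {Q = λ s → reg s rows ≡ n × reg s cols ≡ n × reg s vertices ≡ n × HoldsMatrix (mem s 0) (adj G)
                 × reg s source ≡ 0 × reg s found ≡ 0}
        (order , order , order , matrix , src≡0 , found≡0)
      then λ { {s₀} _ (r , c , ord , mat , src , fd) → map-runs (λ _ (_ , h) → all-rows h) (grid-runs safe
        safe safe
        (fits n≤1+N n≤1+N) (fits₁ n≤1+N) r c
        (λ i s → Inv i 0 s) Inv
        (src , inj₁ (fd , (λ _ _ ()) , λ _ ()))
        (λ s _ _ _ (src , inv) → src , inv)
        (λ {i} {j} s i<n j<n eqi eqj k (src , inv) →
          let read : mem s 0 (reg s source + reg s 3) ≡ bit (extend G i j)
              read = trans (mem-kept k 0 refl _) (trans (cong₂ (λ a b → mem s₀ 0 (a + b)) src eqj)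
                       (matrix-entry G (mem s₀ 0) mat i<n j<n))
          in ifnz-exec {test₁} {(found ≔ lit 1) ⨾ (end₁ ≔ row) ⨾ (end₂ ≔ col)} {skip}
                       {exec (test₁ ≔ 0 ! (var source ⊕ col)) s} (λ s′ → Inv i (suc j) (exec colEnd s′))
            (λ nz → src , inj₂ ((λ ()) , new-edge (λ z → nz (trans read z)) eqi eqj))
            (λ z → src , no-edge inv (trans (sym read) z)))
        (λ {i} s i<n eqi k (src , inv) →
          trans (cong₂ _+_ src (trans (reg-kept k vertices refl) ord)) (+-comm (i * n) n) , next-row inv)) })

  allVertices-runs : ∀ {s} → reg s vertices ≡ n →
    Runs allVertices s 0 100 (λ s′ → reg s′ best ≡ n × (∀ j → j < n → mem s′ 1 j ≡ 1))
  allVertices-runs order = within 100 tt (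
    exec-runs {(best ≔ var vertices) ⨾ (rows ≔ lit 1) ⨾ (cols ≔ var vertices)} tt
      {Q = λ s → reg s rows ≡ 1 × reg s cols ≡ n × reg s best ≡ n}
      (refl , order , order)
    then λ { _ (r , c , b) → map-runs (λ k h → trans (reg-kept k best refl) b , h (s≤s z≤n)) (grid-runs safe
      safe safe
      (fits (s≤s z≤n) n≤1+N) (fits₁ (s≤s z≤n)) r c
      (λ i s → 0 < i → ∀ j → j < n → mem s 1 j ≡ 1) (λ i j s → ∀ j′ → j′ < j → mem s 1 j′ ≡ 1)
      (λ ()) (λ _ _ _ _ _ _ ())
      (λ s _ _ _ eqj _ h → store-next (λ _ x → x ≡ 1) eqj refl h)
      (λ _ _ _ _ h _ → h)) })

  module _ (k : ℕ) (w : ℕ) where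
    private
      A : Arr
      A = copy k 0

      -- The blank part is carried along because an `Input` must be zero beyond its matrix.
      Filled : ℕ → (ℕ → ℕ) → Set
      Filled p f = (∀ i j → j < N → i * N + j < p → f (i * N + j) ≡ bit (gadgetAdj G w i j))
                 × (∀ q → p ≤ q → f q ≡ 0)

      fill-next : ∀ {i j f g t v} → j < N → t ≡ i * N + j → v ≡ bit (gadgetAdj G w i j) →
                  (∀ p → g p ≡ (f [ t ↦ v ]) p) → Filled (i * N + j) f → Filled (i * N + suc j) g
      fill-next {i} {j} {f} {g} {t} {v} j<N refl refl g≗ (written , blank) = written′ , blank′
        where
        written′ : ∀ i′ j′ → j′ < N → i′ * N + j′ < i * N + suc j → g (i′ * N + j′) ≡ bit (gadgetAdj G w i′ j′)
        written′ i′ j′ j′<N lt = trans (g≗ _) (store-next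
          -- Quantifying over all row and column pairs at position `p` avoids decoding `p`;
          -- `index-injective` shows that there is at most one.
          (λ p x → ∀ i′ j′ → j′ < N → p ≡ i′ * N + j′ → x ≡ bit (gadgetAdj G w i′ j′))
          {f} {t} {t} {v} refl
          (λ i′ j′ j′<N eq → let e , e′ = index-injective i i′ j<N j′<N eq in cong₂ (λ i j → bit (gadgetAdj G w i j)) e e′)
          (λ { p p<t i′ j′ j′<N refl → written i′ j′ j′<N p<t })
          _ (subst (i′ * N + j′ <_) (+-suc (i * N) j) lt) i′ j′ j′<N refl)
        blank′ : ∀ q → i * N + suc j ≤ q → g q ≡ 0
        blank′ q le = trans (g≗ q) (trans (cong (λ b → if b then v else f q) (≢⇒≡ᵇ (>⇒≢ t<q))) (blank q (<⇒≤ t<q)))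
          where
          t<q : t < q
          t<q = subst (_≤ q) (+-suc (i * N) j) le

      Inv : ℕ → ℕ → State → Set
      Inv i j s = reg s source ≡ i * n × reg s target ≡ i * N × Filled (i * N + j) (mem s A)

    buildGadget-runs : ∀ {s} → reg s vertices ≡ n → reg s gadgetOrder ≡ N → reg s guess ≡ w →
      HoldsMatrix (mem s 0) (adj G) → (∀ p → mem s A p ≡ 0) →
      Runs (buildGadget A) s 0 200
        (λ s′ → HoldsMatrix (mem s′ A) (adj (gadget G w N)) × (∀ p → N * N ≤ p → mem s′ A p ≡ 0))
    buildGadget-runs order gorder guessed matrix blank = within 200 tt (
      exec-runs {(rows ≔ var gadgetOrder) ⨾ (cols ≔ var gadgetOrder) ⨾ (source ≔ lit 0) ⨾ (target ≔ lit 0)} tt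
        {Q = λ s → reg s rows ≡ N × reg s cols ≡ N × reg s source ≡ 0 × reg s target ≡ 0 × reg s vertices ≡ n
                 × reg s gadgetOrder ≡ N × reg s guess ≡ w × HoldsMatrix (mem s 0) (adj G) × (∀ p → mem s A p ≡ 0)}
        (gorder , gorder , refl , refl , order , gorder , guessed , matrix , blank)
      then λ { {s₀} _ (r , c , src , tgt , ord , gord , gs , mat , blk) → map-runs
        (λ _ (_ , _ , (written , blank)) →
          (λ u v → written (toℕ u) (toℕ v) (toℕ<n v) (index-< 0 (toℕ<n v) (toℕ<n u))) ,
          (λ p le → blank p (subst (_≤ p) (sym (+-identityʳ _)) le)))
        (grid-runs safe
        safe safe
        (fits (n≤1+n N) (n≤1+n N)) (fits₁ (n≤1+n N)) r c
        (λ i s → Inv i 0 s) Inv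
        (src , tgt , (λ { i j _ () }) , λ q _ → blk q)
        (λ _ _ _ _ h → h)
        (λ {i} {j} s i<N j<N eqi eqj kept (src , tgt , filled) →
          src , tgt , fill-next {i} {j} {mem s A} j<N (cong₂ _+_ tgt eqj)
            (cell i j (trans (reg-kept kept vertices refl) ord) (trans (reg-kept kept guess refl) gs) eqi eqj
               (λ i<n j<n → trans (mem-kept kept 0 refl _)
                  (trans (cong₂ (λ a b → mem s₀ 0 (a + b)) src eqj) (matrix-entry G (mem s₀ 0) mat i<n j<n))))
            (mem-setMem-same (exec (eval 8 (var target ⊕ col) ⨾ eval 9 gadgetCell) s) A _ _) filled)
        (λ {i} s _ _ kept (src , tgt , filled) →
          trans (cong₂ _+_ src (trans (reg-kept kept vertices refl) ord)) (+-comm (i * n) n) ,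
          trans (cong₂ _+_ tgt (trans (reg-kept kept gadgetOrder refl) gord)) (+-comm (i * N) N) ,
          subst (λ p → Filled p (mem s A)) (trans (+-comm (i * N) N) (sym (+-identityʳ _))) filled)) })
      where
      cell : ∀ i j {n′ w′ i′ j′ a} → n′ ≡ n → w′ ≡ w → i′ ≡ i → j′ ≡ j →
             (i < n → j < n → a ≡ bit (extend G i j)) → gadgetCellᴺ n′ w′ i′ j′ a ≡ bit (gadgetAdj G w i j)
      cell i j refl refl refl refl read = gadgetCellᴺ≡bit G w i j read

  module _ (k : ℕ) where
    private
      A : Arr
      A = copy k 1

      rowWeight : (ℕ → ℕ) → ℕ → ℕ → ℕ
      rowWeight e i j = suc (sum {j} (λ u → e (i * N + toℕ u)))

    -- In the first alternative the earlier cover was already at least as good as every padding row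
    -- seen. Then too `b` is below all their weights, and this is what the approximation guarantee
    -- uses.
    LightestRow : (e : ℕ → ℕ) (b₀ i b chosen flag : ℕ) → Set
    LightestRow e b₀ i b chosen flag =
      b ≤ b₀ × (∀ x → x < i → n ≤ x → b ≤ suc (sum {n} (λ u → e (x * N + toℕ u)))) ×
      ((flag ≡ 0 × b ≡ b₀) ⊎
       (flag ≡ 1 × ∃ λ x → n ≤ x × x < N × chosen ≡ x * N × b ≡ suc (sum {n} (λ u → e (x * N + toℕ u)))))

    keep-row : ∀ {e b₀ i b ch fl} → LightestRow e b₀ i b ch fl → (n ≤ i → b ≤ rowWeight e i n) →
               LightestRow e b₀ (suc i) b ch fl
    keep-row {e} {i = i} {b} (le , rows , last) here = le , rows′ , last
      where
      rows′ : ∀ x → x < suc i → n ≤ x → b ≤ rowWeight e x n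
      rows′ x x≤i n≤x with m≤n⇒m<n∨m≡n (s≤s⁻¹ x≤i)
      ... | inj₁ x<i  = rows x x<i n≤x
      ... | inj₂ refl = here n≤x

    take-row : ∀ {e b₀ i b ch fl b′ ch′} → LightestRow e b₀ i b ch fl → n ≤ i → i < N →
               b′ ≡ rowWeight e i n → b′ < b → ch′ ≡ i * N → LightestRow e b₀ (suc i) b′ ch′ 1
    take-row {e} {i = i} {b′ = b′} (le , rows , _) n≤i i<N eq b′<b eq′ =
      ≤-trans (<⇒≤ b′<b) le , rows′ , inj₂ (refl , i , n≤i , i<N , eq′ , eq)
      where
      rows′ : ∀ x → x < suc i → n ≤ x → b′ ≤ rowWeight e x n
      rows′ x x≤i n≤x with m≤n⇒m<n∨m≡n (s≤s⁻¹ x≤i)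
      ... | inj₁ x<i  = ≤-trans (<⇒≤ b′<b) (rows x x<i n≤x)
      ... | inj₂ refl = ≤-reflexive eq

    findRow-runs : ∀ {s} → reg s vertices ≡ n → reg s gadgetOrder ≡ N →
      Runs (findRow A) s 0 200
        (λ s′ → LightestRow (mem s A) (reg s best) N (reg s′ best) (reg s′ chosen) (reg s′ improved))
    findRow-runs {s} order gorder = within 200 tt (
      exec-runs {(rows ≔ var gadgetOrder) ⨾ (cols ≔ var vertices) ⨾ (target ≔ lit 0) ⨾ (improved ≔ lit 0)} tt
        {Q = λ s′ → reg s′ rows ≡ N × reg s′ cols ≡ n × reg s′ target ≡ 0 × reg s′ improved ≡ 0 × reg s′ vertices ≡ n
                 × reg s′ gadgetOrder ≡ N × reg s′ best ≡ b₀ × (∀ p → mem s′ A p ≡ e p)}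
        (gorder , order , refl , refl , order , gorder , refl , λ _ → refl)
      then λ { {s₀} _ (r , c , tgt , imp , ord , gord , b≡ , e≗) → map-runs (λ _ (_ , h) → h) (grid-runs
        safe safe safe
        (fits (n≤1+n N) n≤1+N) (fits₁ (n≤1+n N)) r c
        (λ i s → reg s target ≡ i * N × Light i s)
        (λ i j s → reg s target ≡ i * N × reg s weight ≡ rowWeight e i j × Light i s)
        (tgt , ≤-reflexive b≡ , (λ _ ()) , inj₁ (imp , b≡))
        (λ _ _ _ _ (t , l) → t , refl , l)
        (λ {i} {j} s _ _ _ eqj kept (t , wt , l) →
           t , trans (cong₂ _+_ wt (trans (trans (mem-kept kept A refl _) (e≗ _)) (cong₂ (λ a b → e (a + b)) t eqj)))
                     (cong suc (sym (sum-last j (λ x → e (i * N + x))))) , l)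
        (λ {i} s i<N eqi kept (t , wt , l) →
          let next = trans (cong₂ _+_ t (trans (reg-kept kept gadgetOrder refl) gord)) (+-comm (i * N) N)
              ord′ = trans (reg-kept kept vertices refl) ord
              s₁ = exec ((test₁ ≔ (row ⊕ lit 1) ⊖ var vertices) ⨾ (test₂ ≔ var best ⊖ var weight)) s
              Q = λ s′ → reg (exec ((target ≔ var target ⊕ var gadgetOrder) ⨾ rowEnd) s′) target ≡ suc i * N
                       × Light (suc i) (exec ((target ≔ var target ⊕ var gadgetOrder) ⨾ rowEnd) s′)
          in ifnz-exec {test₁} {ifnz test₂ update skip} {skip} {s₁} Q
               (λ nz → ifnz-exec {test₂} {update} {skip} {s₁} Q
                 (λ nz′ → next , take-row {e} l (low ord′ eqi nz) i<N wt (∸≢0⇒< _ _ nz′) t)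
                 (λ z → next , keep-row {e} l (λ _ → subst (reg s best ≤_) wt (m∸n≡0⇒m≤n z))))
               (λ z → next , keep-row {e} l (λ n≤i → contradiction z (high ord′ eqi n≤i))))) })
      where
      e = mem s A
      b₀ = reg s best
      update = (best ≔ var weight) ⨾ (chosen ≔ var target) ⨾ (improved ≔ lit 1)
      Light : ℕ → State → Set
      Light i s′ = LightestRow e b₀ i (reg s′ best) (reg s′ chosen) (reg s′ improved)
      low : ∀ {i i′ n′} → n′ ≡ n → i′ ≡ i → (i′ + 1) ∸ n′ ≢ 0 → n ≤ i
      low {i} refl refl nz = s≤s⁻¹ (subst (n <_) (+-comm i 1) (∸≢0⇒< (i + 1) n nz))
      high : ∀ {i i′ n′} → n′ ≡ n → i′ ≡ i → n ≤ i → (i′ + 1) ∸ n′ ≢ 0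
      high {i} refl refl n≤i z = <⇒≱ (subst (n <_) (+-comm 1 i) (s≤s n≤i)) (m∸n≡0⇒m≤n z)

    private
      safe-cell : SparesCounters (1 [ col ]≔ A ! (var chosen ⊕ col))
      safe-cell = safe

    copyRow-idle : ∀ {s} → reg s vertices ≡ n → reg s improved ≡ 0 →
      Runs (copyRow A) s 0 100 (λ s′ → ∀ p → mem s′ 1 p ≡ mem s 1 p)
    copyRow-idle {s} order z = within 100 tt (
      exec-runs {(rows ≔ var improved) ⨾ (cols ≔ var vertices)} tt
        {Q = λ s′ → reg s′ rows ≡ 0 × reg s′ cols ≡ n × reg s′ improved ≡ 0 × Same s′}
        (z , order , z , λ _ → refl)
      then λ { {s₀} _ (r , c , imp , m) → grid-runs safe safe-cell safe (fits z≤n n≤1+N) (fits₁ z≤n) r c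
        (λ _ → Same) (λ _ _ → Same) m (λ _ ()) (λ _ ()) (λ _ ())
      then λ {s₁} kept m → exec-runs {ifnz improved (1 [ var guess ]≔ lit 1) skip} tt {Q = Same}
        (ifnz-exec {improved} {1 [ var guess ]≔ lit 1} {skip} {s₁} Same
          (λ nz → contradiction (trans (reg-kept kept improved refl) imp) nz)
          (λ _ → m)) })
      where
      Same : State → Set
      Same s′ = ∀ p → mem s′ 1 p ≡ mem s 1 p

    copyRow-runs : ∀ {s} → reg s vertices ≡ n → ∀ (w : Fin n) → reg s guess ≡ toℕ w → reg s improved ≡ 1 →
      Runs (copyRow A) s 0 100 (λ s′ → ∀ j → j < n →
        mem s′ 1 j ≡ (if j ≡ᵇ toℕ w then 1 else mem s A (reg s chosen + j)))
    copyRow-runs {s} order w gs o = within 100 tt (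
      exec-runs {(rows ≔ var improved) ⨾ (cols ≔ var vertices)} tt
        {Q = λ s′ → reg s′ rows ≡ 1 × reg s′ cols ≡ n × reg s′ improved ≡ 1 × reg s′ guess ≡ toℕ w
                  × reg s′ chosen ≡ reg s chosen × (∀ p → mem s′ A p ≡ mem s A p)}
        (o , order , o , gs , refl , λ _ → refl)
      then λ { {s₀} _ (r , c , imp , gs , ch , m) → grid-runs safe safe-cell safe
        (fits (s≤s z≤n) n≤1+N) (fits₁ (s≤s z≤n)) r c
        (λ i s′ → 0 < i → Copied n s′) (λ _ → Copied) (λ ())
        (λ _ _ _ _ _ _ ())
        (λ s′ _ _ _ eqj kept h → store-next (λ j x → x ≡ mem s A (reg s chosen + j)) eqj
           (trans (mem-kept kept A refl _) (trans (m _) (cong₂ (λ a b → mem s A (a + b))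
              (trans (reg-kept kept chosen refl) ch) eqj))) h)
        (λ _ _ _ _ h _ → h)
      then λ {s₁} kept h → exec-runs {ifnz improved (1 [ var guess ]≔ lit 1) skip} tt {Q = Marked}
        (ifnz-exec {improved} {1 [ var guess ]≔ lit 1} {skip} {s₁} Marked
          (λ _ j j<n → trans
            (cong (λ x → if j ≡ᵇ x then 1 else mem s₁ 1 j) (trans (reg-kept kept guess refl) gs))
            (cong (λ x → if j ≡ᵇ toℕ w then 1 else x) (h (s≤s z≤n) j j<n)))
          (λ z → contradiction (trans (sym (trans (reg-kept kept improved refl) imp)) z) λ ())) })
      where
      Copied : ℕ → State → Set
      Copied j s′ = ∀ i → i < j → mem s′ 1 i ≡ mem s A (reg s chosen + i)
      Marked : State → Set
      Marked s′ = ∀ j → j < n → mem s′ 1 j ≡ (if j ≡ᵇ toℕ w then 1 else mem s A (reg s chosen + j))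

-- One run of the given algorithm, in its own copy of the memory

copy-injective : ∀ k → ∀ {x y} → copy k x ≡ copy k y → x ≡ y
copy-injective k {x} {y} eq = *-cancelˡ-≡ x y 2 (+-cancelˡ-≡ k (2 * x) (2 * y) (+-cancelˡ-≡ 32 (k + 2 * x) (k + 2 * y) eq))

-- The copies take the even and the odd numbers from 32 on, above all registers and arrays of the
-- reduction itself.
copies-disjoint : ∀ x y → (copy 1 x ≡ᵇ copy 0 y) ≡ false
copies-disjoint x y = ≢⇒≡ᵇ {suc (2 * x)} {2 * y} (λ eq → even≢odd y x (sym eq))

buildGadget-writes : ∀ {a b} → (b ≡ᵇ a) ≡ false → writesArr (buildGadget a) b ≡ false
buildGadget-writes b≢a rewrite b≢a = refl

≤·-antitone : ∀ {D c} → Gap D c → ∀ a b m → a ≤ b → b ≤ c · m → a ≤ c · m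
≤·-antitone gap a b m a≤b b≤cm = ≤·-intro a m gap (λ {P} {Q} ex → ≤-trans (*-monoˡ-≤ Q a≤b) (≤·-elim b m b≤cm ex))

module Improve {c D} (gap : Gap D c) {f P} (alg : IsApproximation c ClusterDeletion f P)
               {n N} (n≤N : n ≤ N) (N≡ : suc (suc D) * (n * n) ≡ N) (G : Graph n) where

  open Subroutines (f N) N n≤N G
  open Timed (f N) Y (s≤s z≤n)

  record Context (s : State) : Set where
    constructor context
    field
      order  : reg s vertices ≡ n
      gorder : reg s gadgetOrder ≡ N
      matrix : HoldsMatrix (mem s 0) (adj G)

  Clean : ℕ → State → Set
  Clean k s = (∀ x → reg s (copy k x) ≡ 0) × (∀ a p → mem s (copy k a) p ≡ 0)

  -- `best` is only an upper bound: the weight of a row counts the guessed vertex twice if the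
  -- deletion set also separates it from the padding vertex.
  Cover : State → Set
  Cover s = ∃ λ S → (∀ v → mem s 1 (toℕ v) ≡ bit (lookup S v)) × IsVertexCover G S × ∣ S ∣ ≤ reg s best

  Good : Fin n → ℕ → Set
  Good w b = ∀ {S} → IsVertexCover G S → w ∈ S → b ≤ c · ∣ S ∣

  -- The algorithm is run on the view of the state through the renaming, and that run is then
  -- transported back to the full state.
  simulate : ∀ k (w : Fin n) {s} → Input (gadget G (toℕ w) N) (view (copy k) s) →
    Runs (rename (copy k) P) s 1 0 (λ s′ → ∃ λ E → HoldsMatrix (mem s′ (copy k 1)) (adj E) ×
      IsClusterDeletionSet (gadget G (toℕ w) N) E ×
      (∀ m → MinimisationProblem.IsMinimumSize ClusterDeletion (gadget G (toℕ w) N) m → edgeCount E ≤ c · m))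
  simulate k w {s} input =
    let t , s′ , P⇓ , t≤ , E , holds , feasible , approx = alg (gadget G (toℕ w) N) (view (copy k) s) input
        s″ , P⇓′ , same = rename⇓ (copy-injective k) {s = s} P⇓ ((λ _ → refl) , λ _ _ → refl)
    in runs (t , s″ , P⇓′ , ≤-trans t≤ (≤-reflexive (sym (trans (+-identityʳ _) (+-identityʳ _)))) ,
             E , (λ u v → trans (sym (mem-≈ same 1 _)) (holds u v)) , feasible , approx)

  input-ready : ∀ k (w : Fin n) {s s₁ s₂} → Clean k s → Keeps (buildGadget (copy k 0)) s s₁ →
    HoldsMatrix (mem s₁ (copy k 0)) (adj (gadget G (toℕ w) N)) → (∀ p → N * N ≤ p → mem s₁ (copy k 0) p ≡ 0) →
    reg s₁ gadgetOrder ≡ N → s₂ ≡ exec (copy k 0 ≔ var gadgetOrder) s₁ →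
    Input (gadget G (toℕ w) N) (view (copy k) s₂)
  input-ready k w {s} {s₁} (regs , mems) kept holds blank gorder refl = record
    { order      = trans (cong (λ b → if b then reg s₁ gadgetOrder else reg s₁ (copy k 0)) (≡ᵇ-refl (copy k 0))) gorder
    ; matrix     = holds
    ; clean-rest = blank
    ; clean-reg  = λ x x≢0 → trans
        (cong (λ b → if b then reg s₁ gadgetOrder else reg s₁ (copy k x)) (≢⇒≡ᵇ (x≢0 ∘ copy-injective k)))
        (trans (reg-kept kept (copy k x) refl) (regs x))
    ; clean-mem  = λ a a≢0 p → trans
        (mem-kept kept (copy k a) (buildGadget-writes {copy k 0} {copy k a} (≢⇒≡ᵇ (a≢0 ∘ copy-injective k))) p) (mems a p)
    }

  -- That `best` never increases lets the guarantee of the first guess survive the second run.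
  improve-runs : ∀ k (w : Fin n) {s} → Context s → reg s guess ≡ toℕ w → Clean k s → Cover s →
    Runs (improve k P) s 1 700 (λ s′ → Cover s′ × reg s′ best ≤ reg s best × Good w (reg s′ best))
  improve-runs k w {s} (context order gorder matrix) guessed clean (S , holdsS , coverS , sizeS) = relax 1 700 tt tt (
    buildGadget-runs k (toℕ w) order gorder guessed matrix (proj₂ clean 0)
    then λ {s₁} k₁ (holds , blank) →
      exec-runs {copy k 0 ≔ var gadgetOrder} tt {Q = λ s₂ → Input (gadget G (toℕ w) N) (view (copy k) s₂)}
        (input-ready k w clean k₁ holds blank (trans (reg-kept k₁ gadgetOrder refl) gorder) refl)
    then λ {s₂} k₂ input → simulate k w input
    then λ {s₃} k₃ (E , holdsE , feasible , approx) →
      let fresh : ∀ r → (∀ x → (r ≡ᵇ copy k x) ≡ false) → writesReg (buildGadget (copy k 0)) r ≡ false →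
                  writesReg (copy k 0 ≔ var gadgetOrder) r ≡ false → reg s₃ r ≡ reg s r
          fresh r w₃ w₁ w₂ = trans (reg-kept k₃ r (rename-writesReg P w₃)) (trans (reg-kept k₂ r w₂) (reg-kept k₁ r w₁))
          order₃ = trans (fresh vertices (λ _ → refl) refl refl) order
          gorder₃ = trans (fresh gadgetOrder (λ _ → refl) refl refl) gorder
          guessed₃ = trans (fresh guess (λ _ → refl) refl refl) guessed
          best₃ = fresh best (λ _ → refl) refl refl
          cover₃ = λ p → trans (mem-kept k₃ 1 (rename-writesArr P (λ _ → refl)) p)
                               (trans (mem-kept k₂ 1 refl p) (mem-kept k₁ 1 refl p))
      in findRow-runs k order₃ gorder₃
    then λ {s₄} k₄ (b≤ , rows , last) →
      let good : Good w (reg s₄ best)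
          good = guess-correct gap n≤N N≡ G w E approx (λ x n≤x → ≤-trans (rows (toℕ x) (toℕ<n x) n≤x)
            (≤-reflexive (cong suc (row-sum E (mem s₃ (copy k 1)) holdsE x))))
          order₄ = trans (reg-kept k₄ vertices refl) order₃
          guessed₄ = trans (reg-kept k₄ guess refl) guessed₃
      in finish {s₃} {s₄} E feasible holdsE k₄ order₄ guessed₄ good (subst (reg s₄ best ≤_) best₃ b≤)
           (λ eq → S , (λ p → trans (cover₃ (toℕ p)) (holdsS p)) , coverS
                  , ≤-trans sizeS (≤-reflexive (sym (trans eq best₃))))
           last)
    where
    row-sum : ∀ (E : Graph N) (e : ℕ → ℕ) → HoldsMatrix e (adj E) → ∀ x →
              sum {n} (λ u → e (toℕ x * N + toℕ u)) ≡ rowSum n≤N G w E x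
    row-sum E e holds x = sum-cong-≗ {n} (λ u →
      trans (cong (λ j → e (toℕ x * N + j)) (sym (toℕ-inject≤ u n≤N))) (holds x (inject≤ u n≤N)))

    A = copy k 1

    finish : ∀ {s₃ s₄} (E : Graph N) → IsClusterDeletionSet (gadget G (toℕ w) N) E →
      HoldsMatrix (mem s₃ A) (adj E) → Keeps (findRow A) s₃ s₄ → reg s₄ vertices ≡ n → reg s₄ guess ≡ toℕ w →
      Good w (reg s₄ best) → reg s₄ best ≤ reg s best →
      (reg s₄ best ≡ reg s₃ best → ∃ λ S → (∀ v → mem s₃ 1 (toℕ v) ≡ bit (lookup S v)) ×
         IsVertexCover G S × ∣ S ∣ ≤ reg s₄ best) →
      ((reg s₄ improved ≡ 0 × reg s₄ best ≡ reg s₃ best) ⊎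
       (reg s₄ improved ≡ 1 × ∃ λ x → n ≤ x × x < N × reg s₄ chosen ≡ x * N ×
          reg s₄ best ≡ suc (sum {n} (λ u → mem s₃ A (x * N + toℕ u))))) →
      Runs (copyRow A) s₄ 0 100 (λ s′ → Cover s′ × reg s′ best ≤ reg s best × Good w (reg s′ best))
    finish {s₃} {s₄} E feasible holdsE k₄ order₄ guessed₄ good b≤ old (inj₁ (imp , eq)) =
      map-runs (λ {s₅} k₅ same →
          let b₅ = reg-kept k₅ best refl ; S , holds , cov , sz = old eq
          in (S , (λ v → trans (same (toℕ v)) (trans (mem-kept k₄ 1 refl _) (holds v))) , cov
               , ≤-trans sz (≤-reflexive (sym b₅)))
             , ≤-trans (≤-reflexive b₅) b≤ , (λ {S} → subst (λ b → Good w b) (sym b₅) good {S}))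
        (copyRow-idle k order₄ imp)
    finish {s₃} {s₄} E feasible holdsE k₄ order₄ guessed₄ good b≤ old (inj₂ (imp , x , n≤x , x<N , ch , eq)) =
      map-runs (λ {s₅} k₅ copied →
          let b₅ = reg-kept k₅ best refl
          in (rowCover n≤N G w E x′ , stored s₅ copied
             , rowCover-isVertexCover n≤N G w E feasible x′ (subst (n ≤_) (sym x≡) n≤x)
             , ≤-trans (rowCover-size n≤N G w E x′) (≤-reflexive (sym (trans b₅ (trans eq (cong suc
                 (trans (cong (λ x → sum {n} (λ u → mem s₃ A (x * N + toℕ u))) (sym x≡))
                        (row-sum E (mem s₃ A) holdsE x′))))))))
             , ≤-trans (≤-reflexive b₅) b≤ , (λ {S} → subst (λ b → Good w b) (sym b₅) good {S}))
        (copyRow-runs k order₄ w guessed₄ imp)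
      where
      x′ = fromℕ< x<N
      x≡ = toℕ-fromℕ< x<N
      entry : ∀ v → mem s₄ A (reg s₄ chosen + toℕ v) ≡ bit (adj E x′ (inject≤ v n≤N))
      entry v = trans (mem-kept k₄ A refl _) (trans (cong (mem s₃ A)
        (cong₂ _+_ (trans ch (cong (_* N) (sym x≡))) (sym (toℕ-inject≤ v n≤N)))) (holdsE x′ (inject≤ v n≤N)))
      mark : ∀ b e {m} → m ≡ bit e → (if b then 1 else m) ≡ bit (e ∨ b)
      mark true  true  _    = refl
      mark true  false _    = refl
      mark false true  refl = refl
      mark false false refl = refl
      stored : ∀ s₅ → (∀ j → j < n → mem s₅ 1 j ≡ (if j ≡ᵇ toℕ w then 1 else mem s₄ A (reg s₄ chosen + j))) →
               ∀ v → mem s₅ 1 (toℕ v) ≡ bit (lookup (rowCover n≤N G w E x′) v)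
      stored s₅ copied v = trans (copied (toℕ v) (toℕ<n v)) (trans
        (mark (toℕ v ≡ᵇ toℕ w) (adj E x′ (inject≤ v n≤N)) (entry v))
        (cong bit (sym (lookup∘tabulate (λ u → adj E x′ (inject≤ u n≤N) ∨ (toℕ u ≡ᵇ toℕ w)) v))))

-- The complete algorithm for vertex cover

module Solve {c D} (gap : Gap D c) {f P} (alg : IsApproximation c ClusterDeletion f P)
             {n} (G : Graph n) where

  N : ℕ
  N = suc (suc D) * n ^ 2

  nn≡ : n * n ≡ n ^ 2
  nn≡ = cong (n *_) (sym (*-identityʳ n))

  N≡ : suc (suc D) * (n * n) ≡ N
  N≡ = cong (suc (suc D) *_) nn≡

  nn≤N : n * n ≤ N
  nn≤N = ≤-trans (m≤m+n (n * n) (suc D * (n * n))) (≤-reflexive N≡)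

  n≤nn : ∀ n → n ≤ n * n
  n≤nn zero    = z≤n
  n≤nn (suc n) = m≤m*n (suc n) (suc n)

  n≤N : n ≤ N
  n≤N = ≤-trans (n≤nn n) nn≤N

  open Subroutines (f N) N n≤N G
  open Improve gap alg n≤N N≡ G
  open Timed (f N) Y (s≤s z≤n)

  Solved : State → Set
  Solved s = ∃ λ S → (∀ v → mem s 1 (toℕ v) ≡ bit (lookup S v)) × IsVertexCover G S ×
               (∀ m → MinimisationProblem.IsMinimumSize VertexCover G m → ∣ S ∣ ≤ c · m)

  record Stage (w : Fin n) (s₀ s : State) : Set where
    constructor stage
    field
      ctx    : Context s
      gs     : reg s guess ≡ toℕ w
      cover  : Cover s
      second : reg s end₂ ≡ reg s₀ end₂
      clean  : Clean 1 s

  edge-case : ∀ {u v} → Adj G u v → ∀ {s} → Context s → reg s end₁ ≡ toℕ u → reg s end₂ ≡ toℕ v →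
              Clean 0 s → Clean 1 s →
    Runs (allVertices ⨾ (guess ≔ var end₁) ⨾ improve 0 P ⨾ (guess ≔ var end₂) ⨾ improve 1 P) s 2 1600 Solved
  edge-case {u} {v} uv {s} (context order gorder matrix) e₁ e₂ clean₀ clean₁ = relax 2 1600 tt tt (
    allVertices-runs order
    then λ {s₁} k₁ (b₁ , ones) →
      exec-runs {guess ≔ var end₁} tt {Q = λ s₂ → Stage u s s₂ × Clean 0 s₂}
        (stage (context (trans (reg-kept k₁ vertices refl) order) (trans (reg-kept k₁ gadgetOrder refl) gorder)
                 (λ x y → trans (mem-kept k₁ 0 refl _) (matrix x y)))
               (trans (reg-kept k₁ end₁ refl) e₁)
               (⊤ , (λ x → trans (ones (toℕ x) (toℕ<n x)) (cong bit (sym (lookup-replicate x inside))))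
                  , (λ _ _ _ → inj₁ ∈⊤) , ≤-reflexive (trans (∣⊤∣≡n n) (sym b₁)))
               (reg-kept k₁ end₂ refl)
               ((λ x → trans (reg-kept k₁ (copy 1 x) refl) (proj₁ clean₁ x)) ,
                λ a p → trans (mem-kept k₁ (copy 1 a) refl p) (proj₂ clean₁ a p))
        , ((λ x → trans (reg-kept k₁ (copy 0 x) refl) (proj₁ clean₀ x)) ,
           λ a p → trans (mem-kept k₁ (copy 0 a) refl p) (proj₂ clean₀ a p)))
    then λ {s₂} _ (stage ctx@(context order gorder matrix) gs cover e₂≡ clean₁ , clean₀) →
      improve-runs 0 u ctx gs clean₀ cover
    then λ {s₃} k₃ (cover , b₃ , good₁) →
      exec-runs {guess ≔ var end₂} tt {Q = λ s₄ → Stage v s s₄ × reg s₄ best ≡ reg s₃ best}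
        (stage (context (trans (reg-kept k₃ vertices (keep-reg vertices refl (λ _ → refl))) order)
                        (trans (reg-kept k₃ gadgetOrder (keep-reg gadgetOrder refl (λ _ → refl))) gorder)
                        (λ x y → trans (mem-kept k₃ 0 (keep-arr 0 refl (λ _ → refl)) _) (matrix x y)))
               (trans (reg-kept k₃ end₂ (keep-reg end₂ refl (λ _ → refl))) (trans e₂≡ e₂))
               cover
               (trans (reg-kept k₃ end₂ (keep-reg end₂ refl (λ _ → refl))) e₂≡)
               ((λ x → trans (reg-kept k₃ (copy 1 x) (keep-reg (copy 1 x) refl (copies-disjoint x))) (proj₁ clean₁ x))
               , λ a p → trans (mem-kept k₃ (copy 1 a) (keep-arr (copy 1 a) refl (copies-disjoint a)) p) (proj₂ clean₁ a p))
        , refl)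
    then λ {s₄} _ (stage ctx gs cover _ clean₁ , b₄) → map-runs
      (λ {s₅} _ ((S , holds , covers , size) , b₅ , good₂) → S , holds , covers ,
         -- The optimal cover `S*` contains `u` or `v`. In the first case the guarantee of the first
         -- run passes to the final `best`, which is no larger.
         λ m ((S* , covers* , size*) , _) → subst (∣ S ∣ ≤ c ·_) size* (≤·-antitone gap _ _ ∣ S* ∣ size
           ([ (λ u∈ → ≤·-antitone gap _ _ ∣ S* ∣ (≤-trans b₅ (≤-reflexive b₄)) (good₁ covers* u∈))
            , good₂ covers* ]′ (covers* u v uv))))
      (improve-runs 1 v ctx gs clean₁ cover))
    where
    -- With `P` unknown the write set does not compute; outside the copy it agrees with that of
    -- `improve 0 skip`, which does.
    keep-reg : ∀ r → writesReg (improve 0 skip) r ≡ false →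
               (∀ x → (r ≡ᵇ copy 0 x) ≡ false) → writesReg (improve 0 P) r ≡ false
    keep-reg r h fresh rewrite rename-writesReg P {r} fresh = h

    keep-arr : ∀ a → writesArr (improve 0 skip) a ≡ false →
               (∀ x → (a ≡ᵇ copy 0 x) ≡ false) → writesArr (improve 0 P) a ≡ false
    keep-arr a h fresh rewrite rename-writesArr P {a} fresh = h

  solve-runs : ∀ {s} → Input G s → Runs (approximateCover (suc (suc D)) P) s 2 2000 Solved
  solve-runs {s} input = relax 2 2000 tt tt (
    measure-runs (suc (suc D)) nn≤N (trans (*-comm (n * n) (suc (suc D))) N≡) order
      (clean-reg square λ ()) (clean-reg gadgetOrder λ ())
    then λ {s₁} k₁ gorder → findEdge-runs (trans (reg-kept k₁ vertices refl) order)
           (λ u v → trans (mem-kept k₁ 0 refl _) (matrix u v))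
           (trans (reg-kept k₁ source refl) (clean-reg source λ ()))
           (trans (reg-kept k₁ found refl) (clean-reg found λ ()))
    then λ {s₂} k₂ → λ
      { (inj₁ (z , none)) → ifz-runs z (relax 2 1600 tt tt (exec-runs {skip} tt {Q = Solved}
          (⊥ , (λ v → trans (mem-kept k₂ 1 refl _) (trans (mem-kept k₁ 1 refl _) (trans (clean-mem 1 (λ ()) _)
                 (cong bit (sym (lookup-replicate v outside))))))
             , (λ u v uv → contradiction uv (none u v))
             , λ m _ → subst (_≤ c · m) (sym (∣⊥∣≡0 n)) (≤·-intro 0 m gap (λ _ → z≤n)))))
      ; (inj₂ (nz , u , v , e₁ , e₂ , uv)) → ifnz-runs nz (edge-case uv
          (context (trans (reg-kept k₂ vertices refl) (trans (reg-kept k₁ vertices refl) order))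
                   (trans (reg-kept k₂ gadgetOrder refl) gorder)
                   (λ u v → trans (mem-kept k₂ 0 refl _) (trans (mem-kept k₁ 0 refl _) (matrix u v))))
          e₁ e₂ (still-clean 0 k₁ k₂) (still-clean 1 k₁ k₂))
      })
    where
    open Input input
    still-clean : ∀ k {s₁ s₂} → Keeps (measure (suc (suc D))) s s₁ → Keeps findEdge s₁ s₂ → Clean k s₂
    still-clean k k₁ k₂ =
      (λ x → trans (reg-kept k₂ (copy k x) refl) (trans (reg-kept k₁ (copy k x) refl) (clean-reg (copy k x) λ ()))) ,
      (λ a p → trans (mem-kept k₂ (copy k a) refl p) (trans (mem-kept k₁ (copy k a) refl p) (clean-mem (copy k a) (λ ()) p)))

  solve-halts : ∀ {s} → Input G s → ∃₂ λ t s′ → approximateCover (suc (suc D)) P ∶ s ⇓[ t ] s′ ×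
                t ≤ 2 * f N + 2000 * (suc N * suc N) × Solved s′
  solve-halts input = Runs.halts (solve-runs input)

-- The running time

time : ℕ → (ℕ → ℕ) → ℕ → ℕ
time c′ f n = 2 * f N + 2000 * (suc N * suc N)
  where N = c′ * n ^ 2

-- The bound starts at `n = 1`: for `n = 0` the right-hand side vanishes if `f 0` does, while the
-- running time bound stays positive. From 1 on, `suc N` is at most `suc c′ * n ^ 2`.
time-bound : ∀ c′ f → time c′ f ∈O (λ n → f (c′ * n ^ 2) + n ^ 4)
time-bound c′ f = 2 + K , 1 , bound
  where
  open ≤-Reasoning
  K = 2000 * (suc c′ * suc c′)
  module _ (n : ℕ) (1≤n : 1 ≤ n) where
    N = c′ * n ^ 2
    1+N≤ : suc N ≤ suc c′ * n ^ 2
    1+N≤ = +-monoˡ-≤ N (m^n>0 n {{>-nonZero 1≤n}} 2)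
    square-bound : suc N * suc N ≤ (suc c′ * suc c′) * n ^ 4
    square-bound = begin
      suc N * suc N                           ≤⟨ *-mono-≤ 1+N≤ 1+N≤ ⟩
      (suc c′ * n ^ 2) * (suc c′ * n ^ 2)     ≡⟨ [m*n]*[o*p]≡[m*o]*[n*p] (suc c′) (n ^ 2) (suc c′) (n ^ 2) ⟩
      (suc c′ * suc c′) * (n ^ 2 * n ^ 2)     ≡⟨ cong (suc c′ * suc c′ *_) (^-distribˡ-+-* n 2 2) ⟨
      (suc c′ * suc c′) * n ^ 4               ∎
    bound : time c′ f n ≤ (2 + K) * (f N + n ^ 4)
    bound = begin
      2 * f N + 2000 * (suc N * suc N)                  ≤⟨ +-monoʳ-≤ (2 * f N) (*-monoʳ-≤ 2000 square-bound) ⟩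
      2 * f N + 2000 * ((suc c′ * suc c′) * n ^ 4)      ≡⟨ cong (2 * f N +_) (*-assoc 2000 (suc c′ * suc c′) (n ^ 4)) ⟨
      2 * f N + K * n ^ 4                               ≤⟨ +-mono-≤ (*-monoˡ-≤ (f N) (m≤m+n 2 K)) (*-monoˡ-≤ (n ^ 4) (m≤n+m K 2)) ⟩
      (2 + K) * f N + (2 + K) * n ^ 4                   ≡⟨ *-distribˡ-+ (2 + K) (f N) (n ^ 4) ⟨
      (2 + K) * (f N + n ^ 4)                           ∎

theorem1p2 : (c : ℝ) → 1ℚ <ℝ c →
    ∃ λ (c′ : ℕ) → (f : ℕ → ℕ) →
    f -timeApproximation c For ClusterDeletion →
    ∃ λ (g : ℕ → ℕ) →
    (g ∈O (λ n → f (c′ * n ^ 2) + n ^ 4)) ×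
    (g -timeApproximation c For VertexCover)
theorem1p2 c 1<c = let D , gap = gap-above-one c 1<c in
  suc (suc D) , λ f (P , alg) → time (suc (suc D)) f , time-bound (suc (suc D)) f ,
    approximateCover (suc (suc D)) P , λ G s input → Solve.solve-halts gap alg G input
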